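{- In the setting below, for every $i=1,2,\dots,9$, $$[\Psi^{ -\{ed,fc,f\}}_{ab}(F\mid e)]_{[i]}=M[i,9]\cdot\Psi(K\mid c).$$ (That is, the maximal matchings counted contain neither $ed$ nor $fc$, cover $e$, and leave $f$ uncovered.)
   Context: A matching is maximal if it is not contained in a larger matching; $\Psi(X)$ is the number of maximal matchings of a graph $X$ (the empty graph has one). For a graph $X$ and collections $A,B$ of vertices and edges of $X$, $\Psi^{ -A}(X\mid B)$ is the number of maximal matchings of $X$ that cover every vertex in $B$, contain every edge in $B$, leave every vertex in $A$ uncovered and contain no edge in $A$ (omitted $A$ or $B$ means no such constraint). $X-v$ deletes a vertex, $X-uv$ deletes an edge; $\Psi(X-v)$ counts maximal matchings of the subgraph $X-v$. For an edge $xy$ of $X$, $\Psi^{ -A}_{xy}(X\mid B)=(\Psi^{ -A}(X\mid B),\Psi^{ -A}(X-x\mid B),\Psi^{ -A}(X-y\mid B),\Psi^{ -A}(X-x-y\mid B),\Psi^{ -A}(X\mid x,y,B),\Psi^{ -A}(X-x\mid y,B),\Psi^{ -A}(X-y\mid x,B),\Psi^{ -A}(X\mid x,B),\Psi^{ -A}(X\mid y,B))^T$; $[v]_{[i]}$ is its $i$-th component and $M[i,j]$ the $(i,j)$ entry of $M$. Setting. $H$ is a hexagonal ring: a 2-connected plane graph with hexagons $H_1,\dots,H_n$ arranged cyclically, $H_{i-1},H_i$ sharing exactly one edge $e_i$ ($i=2,\dots,n$), $H_n,H_1$ sharing exactly one edge $e_1$, no other pairs sharing edges, each vertex on at most two hexagons.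 With a fixed planar embedding, $k_i\in\{1,2,3\}$ is the number of edges of $H_i$ strictly between $e_i$ and $e_{i+1}$ when $H_i$ is traversed clockwise from $e_i$ (indices mod $n$), $M_i=t(k_i)$, $f(t(1))=L$, $f(t(2))=S$, $f(t(3))=R$, and $M=f(M_1)f(M_2)\cdots f(M_n)$, where $S=\begin{pmatrix}1&1&1&1&1&1&1&0&0\\0&1&0&1&0&0&1&1&0\\0&0&1&1&0&1&0&0&1\\0&0&0&1&1&1&1&0&0\\1&0&0&1&1&1&1&0&0\\0&1&0&0&0&0&0&1&0\\0&0&1&0&0&0&0&0&1\\1&0&1&1&1&1&1&0&0\\1&1&0&1&1&1&1&0&0\end{pmatrix}$, $L=\begin{pmatrix}1&1&1&1&1&1&1&0&0\\1&0&1&0&0&0&0&0&1\\0&1&0&1&0&0&1&1&0\\1&0&1&0&0&0&0&0&0\\1&0&1&1&0&1&0&0&0\\0&0&1&0&0&0&0&0&1\\0&1&0&1&0&0&0&0&0\\1&1&1&1&0&1&0&0&0\\1&0&1&1&1&1&1&0&0\end{pmatrix}$, $R=\begin{pmatrix}1&1&1&1&1&1&1&0&0\\0&0&1&1&0&1&0&0&1\\1&1&0&0&0&0&0&1&0\\1&1&0&0&0&0&0&0&0\\1&1&0&1&0&0&1&0&0\\0&0&1&1&0&0&0&0&0\\0&1&0&0&0&0&0&1&0\\1&1&0&1&1&1&1&0&0\\1&1&1&1&0&0&1&0&0\end{pmatrix}$. Write $e_1=dc$, where $d$ precedes $c$ when $H_n$ is traversed clockwise; $e$ is the neighbour of $d$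 on $H_n$ other than $c$, and $f$ is the neighbour of $c$ on $H_n$ other than $d$. $G$ is the hexagonal chain obtained by cutting $H$ along $dc$: $d,c$ and the edge $dc$ stay with $H_n$, while on $H_1$ they are replaced by new vertices $a$ (copy of $d$) and $b$ (copy of $c$) joined by the edge $ab$, the edges of $H_1$ formerly incident to $d$ (resp. $c$) becoming incident to $a$ (resp. $b$). $K$ is an arbitrary graph containing the edge $dc$ with $V(K)\cap V(G)=\{d,c\}$ and $E(K)\cap E(G)=\{dc\}$, and $F=G\cup K$. -}

module Defs where

open import Data.Nat using (ℕ; zero; suc; _+_; _*_; _≡ᵇ_)
open import Data.Bool using (Bool; true; false; _∧_; _∨_; not; if_then_else_)
open import Data.List using (List; []; _∷_; _++_; map; upTo; allFin; filterᵇ)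
open import Data.Bool.ListAction using (all; any)
open import Data.Nat.ListAction using (sum)
open import Data.Vec using (Vec; []; _∷_; lookup; last; toList)
open import Data.Fin using (Fin; zero; suc; toℕ)
open import Data.Product using (_×_; _,_)

-- Finite simple graphs with vertices labelled by natural numbers.
-- V = vertex list, E = edge list; an edge (u , v) is unordered.

Edge : Set
Edge = ℕ × ℕ

record Graph : Set where
  constructor graph
  field
    V : List ℕ
    E : List Edge
open Graph public

memV : ℕ → List ℕ → Bool
memV v vs = any (λ w → v ≡ᵇ w) vs

sameEdge : Edge → Edge → Bool
sameEdge (u , v) (x , y) = ((u ≡ᵇ x) ∧ (v ≡ᵇ y)) ∨ ((u ≡ᵇ y) ∧ (v ≡ᵇ x))

memE : Edge → List Edge → Bool
memE e es = any (sameEdge e) es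

incident : ℕ → Edge → Bool
incident v (x , y) = (v ≡ᵇ x) ∨ (v ≡ᵇ y)

disjointE : Edge → Edge → Bool
disjointE (u , v) e = not (incident u e) ∧ not (incident v e)

noDupE : List Edge → Bool
noDupE [] = true
noDupE (e ∷ es) = not (memE e es) ∧ noDupE es

simpleGraph : Graph → Bool
simpleGraph X =
  all (λ { (u , v) → not (u ≡ᵇ v) ∧ memV u (V X) ∧ memV v (V X) }) (E X)
  ∧ noDupE (E X)

-- all sublists (= all subsets of the edge set, when edges are not repeated)
sublists : {A : Set} → List A → List (List A)
sublists [] = [] ∷ []
sublists (x ∷ xs) = sublists xs ++ map (x ∷_) (sublists xs)

isMatching : List Edge → Bool
isMatching [] = true
isMatching (e ∷ m) = all (disjointE e) m ∧ isMatching m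

subsetE : List Edge → List Edge → Bool
subsetE m m' = all (λ e → memE e m') m

-- m is a maximal matching of X (m is taken among the subsets of E X):
-- m is a matching and it is not contained in a larger matching of X,
-- i.e. every matching m' of X with m ⊆ m' satisfies m' ⊆ m.
isMaximalMatching : Graph → List Edge → Bool
isMaximalMatching X m =
  isMatching m ∧
  all (λ m' → not (isMatching m' ∧ subsetE m m') ∨ subsetE m' m) (sublists (E X))

data Item : Set where
  vtx : ℕ → Item
  edg : ℕ → ℕ → Item

covers : List Edge → ℕ → Bool
covers m v = any (incident v) m

satB : List Edge → Item → Bool
satB m (vtx v) = covers m v
satB m (edg u v) = memE (u , v) m

satA : List Edge → Item → Bool
satA m (vtx v) = not (covers m v)
satA m (edg u v) = not (memE (u , v) m)

count : {A : Set} → (A → Bool) → List A → ℕ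
count p [] = 0
count p (x ∷ xs) = if p x then suc (count p xs) else count p xs

Ψ⁻ : List Item → Graph → List Item → ℕ
Ψ⁻ A X B = count (λ m → isMaximalMatching X m ∧ all (satA m) A ∧ all (satB m) B)
                 (sublists (E X))

Ψ∣ : Graph → List Item → ℕ
Ψ∣ X B = Ψ⁻ [] X B

Ψ : Graph → ℕ
Ψ X = Ψ⁻ [] X []

delV : Graph → ℕ → Graph
delV X v = graph (filterᵇ (λ w → not (v ≡ᵇ w)) (V X))
                 (filterᵇ (λ e → not (incident v e)) (E X))

_∪G_ : Graph → Graph → Graph
X ∪G Y = graph (V X ++ V Y) (E X ++ filterᵇ (λ e → not (memE e (E X))) (E Y))

-- the vector Ψ^{-A}_{xy}(X | B), components indexed 0..8 (= 1..9 in the paper)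
Ψvec : List Item → Graph → ℕ → ℕ → List Item → Fin 9 → ℕ
Ψvec A X x y B zero = Ψ⁻ A X B
Ψvec A X x y B (suc zero) = Ψ⁻ A (delV X x) B
Ψvec A X x y B (suc (suc zero)) = Ψ⁻ A (delV X y) B
Ψvec A X x y B (suc (suc (suc zero))) = Ψ⁻ A (delV (delV X x) y) B
Ψvec A X x y B (suc (suc (suc (suc zero)))) = Ψ⁻ A X (vtx x ∷ vtx y ∷ B)
Ψvec A X x y B (suc (suc (suc (suc (suc zero))))) = Ψ⁻ A (delV X x) (vtx y ∷ B)
Ψvec A X x y B (suc (suc (suc (suc (suc (suc zero)))))) = Ψ⁻ A (delV X y) (vtx x ∷ B)
Ψvec A X x y B (suc (suc (suc (suc (suc (suc (suc zero))))))) = Ψ⁻ A X (vtx x ∷ B)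
Ψvec A X x y B (suc (suc (suc (suc (suc (suc (suc (suc zero)))))))) = Ψ⁻ A X (vtx y ∷ B)

Mat : Set
Mat = Fin 9 → Fin 9 → ℕ

fromRows : Vec (Vec ℕ 9) 9 → Mat
fromRows rows i j = lookup (lookup rows i) j

_⊗_ : Mat → Mat → Mat
(P ⊗ Q) i j = sum (map (λ k → P i k * Q k j) (allFin 9))

idM : Mat
idM i j = if toℕ i ≡ᵇ toℕ j then 1 else 0

Smat : Mat
Smat = fromRows
  ( (1 ∷ 1 ∷ 1 ∷ 1 ∷ 1 ∷ 1 ∷ 1 ∷ 0 ∷ 0 ∷ [])
  ∷ (0 ∷ 1 ∷ 0 ∷ 1 ∷ 0 ∷ 0 ∷ 1 ∷ 1 ∷ 0 ∷ [])
  ∷ (0 ∷ 0 ∷ 1 ∷ 1 ∷ 0 ∷ 1 ∷ 0 ∷ 0 ∷ 1 ∷ [])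
  ∷ (0 ∷ 0 ∷ 0 ∷ 1 ∷ 1 ∷ 1 ∷ 1 ∷ 0 ∷ 0 ∷ [])
  ∷ (1 ∷ 0 ∷ 0 ∷ 1 ∷ 1 ∷ 1 ∷ 1 ∷ 0 ∷ 0 ∷ [])
  ∷ (0 ∷ 1 ∷ 0 ∷ 0 ∷ 0 ∷ 0 ∷ 0 ∷ 1 ∷ 0 ∷ [])
  ∷ (0 ∷ 0 ∷ 1 ∷ 0 ∷ 0 ∷ 0 ∷ 0 ∷ 0 ∷ 1 ∷ [])
  ∷ (1 ∷ 0 ∷ 1 ∷ 1 ∷ 1 ∷ 1 ∷ 1 ∷ 0 ∷ 0 ∷ [])
  ∷ (1 ∷ 1 ∷ 0 ∷ 1 ∷ 1 ∷ 1 ∷ 1 ∷ 0 ∷ 0 ∷ [])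
  ∷ [])

Lmat : Mat
Lmat = fromRows
  ( (1 ∷ 1 ∷ 1 ∷ 1 ∷ 1 ∷ 1 ∷ 1 ∷ 0 ∷ 0 ∷ [])
  ∷ (1 ∷ 0 ∷ 1 ∷ 0 ∷ 0 ∷ 0 ∷ 0 ∷ 0 ∷ 1 ∷ [])
  ∷ (0 ∷ 1 ∷ 0 ∷ 1 ∷ 0 ∷ 0 ∷ 1 ∷ 1 ∷ 0 ∷ [])
  ∷ (1 ∷ 0 ∷ 1 ∷ 0 ∷ 0 ∷ 0 ∷ 0 ∷ 0 ∷ 0 ∷ [])
  ∷ (1 ∷ 0 ∷ 1 ∷ 1 ∷ 0 ∷ 1 ∷ 0 ∷ 0 ∷ 0 ∷ [])
  ∷ (0 ∷ 0 ∷ 1 ∷ 0 ∷ 0 ∷ 0 ∷ 0 ∷ 0 ∷ 1 ∷ [])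
  ∷ (0 ∷ 1 ∷ 0 ∷ 1 ∷ 0 ∷ 0 ∷ 0 ∷ 0 ∷ 0 ∷ [])
  ∷ (1 ∷ 1 ∷ 1 ∷ 1 ∷ 0 ∷ 1 ∷ 0 ∷ 0 ∷ 0 ∷ [])
  ∷ (1 ∷ 0 ∷ 1 ∷ 1 ∷ 1 ∷ 1 ∷ 1 ∷ 0 ∷ 0 ∷ [])
  ∷ [])

Rmat : Mat
Rmat = fromRows
  ( (1 ∷ 1 ∷ 1 ∷ 1 ∷ 1 ∷ 1 ∷ 1 ∷ 0 ∷ 0 ∷ [])
  ∷ (0 ∷ 0 ∷ 1 ∷ 1 ∷ 0 ∷ 1 ∷ 0 ∷ 0 ∷ 1 ∷ [])
  ∷ (1 ∷ 1 ∷ 0 ∷ 0 ∷ 0 ∷ 0 ∷ 0 ∷ 1 ∷ 0 ∷ [])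
  ∷ (1 ∷ 1 ∷ 0 ∷ 0 ∷ 0 ∷ 0 ∷ 0 ∷ 0 ∷ 0 ∷ [])
  ∷ (1 ∷ 1 ∷ 0 ∷ 1 ∷ 0 ∷ 0 ∷ 1 ∷ 0 ∷ 0 ∷ [])
  ∷ (0 ∷ 0 ∷ 1 ∷ 1 ∷ 0 ∷ 0 ∷ 0 ∷ 0 ∷ 0 ∷ [])
  ∷ (0 ∷ 1 ∷ 0 ∷ 0 ∷ 0 ∷ 0 ∷ 0 ∷ 1 ∷ 0 ∷ [])
  ∷ (1 ∷ 1 ∷ 0 ∷ 1 ∷ 1 ∷ 1 ∷ 1 ∷ 0 ∷ 0 ∷ [])
  ∷ (1 ∷ 1 ∷ 1 ∷ 1 ∷ 0 ∷ 0 ∷ 1 ∷ 0 ∷ 0 ∷ [])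
  ∷ [])

-- Hexagonal rings, described by n and the sequence k_1 … k_n ∈ {1,2,3}.

data K3 : Set where
  k1 k2 k3 : K3

fMat : K3 → Mat
fMat k1 = Lmat
fMat k2 = Smat
fMat k3 = Rmat

prodMat : List K3 → Mat
prodMat [] = idM
prodMat (k ∷ ks) = fMat k ⊗ prodMat ks

Mring : {n : ℕ} → Vec K3 n → Mat
Mring ks = prodMat (toList ks)

-- Vertex labelling of the chain G (hexagons H_1 … H_n are j = 0 … n-1).
-- Hexagon j, traversed clockwise starting with the edge e_{j+1} = s t, is
--   s=4j, t=4j+1, (k_{j+1} edges) u=4j+5, w=4j+4, (4-k_{j+1} edges) back to s,
-- with the two remaining vertices x=4j+2, y=4j+3 placed in this order:
--   k=1 : s t u w x y     k=2 : s t x u w y     k=3 : s t x y u w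
-- The shared edge e_{j+2} is u w, traversed w → u on hexagon j+1
-- (s_{j+1} = w_j, t_{j+1} = u_j).  Thus b = s_0 = 0, a = t_0 = 1,
-- d = u_{n-1} = 4n+1, c = w_{n-1} = 4n (d precedes c on H_n clockwise).
-- The listed edges of hexagon j are its edges other than s t.
hexEdges : ℕ → K3 → List Edge
hexEdges j k1 = let s = 4 * j in
  (s + 1 , s + 5) ∷ (s + 5 , s + 4) ∷ (s + 4 , s + 2) ∷ (s + 2 , s + 3) ∷ (s + 3 , s) ∷ []
hexEdges j k2 = let s = 4 * j in
  (s + 1 , s + 2) ∷ (s + 2 , s + 5) ∷ (s + 5 , s + 4) ∷ (s + 4 , s + 3) ∷ (s + 3 , s) ∷ []
hexEdges j k3 = let s = 4 * j in
  (s + 1 , s + 2) ∷ (s + 2 , s + 3) ∷ (s + 3 , s + 5) ∷ (s + 5 , s + 4) ∷ (s + 4 , s) ∷ []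

chainEdges : ℕ → List K3 → List Edge
chainEdges j [] = []
chainEdges j (k ∷ ks) = hexEdges j k ++ chainEdges (suc j) ks

-- the hexagonal chain G obtained by cutting the ring along dc
chainG : {n : ℕ} → Vec K3 n → Graph
chainG {n} ks = graph (upTo (4 * n + 2)) ((0 , 1) ∷ chainEdges 0 (toList ks))

vA vB : ℕ
vA = 1
vB = 0

vD vC : ℕ → ℕ
vD n = 4 * n + 1
vC n = 4 * n

-- e : neighbour of d on H_n other than c ; f : neighbour of c on H_n other than d
vE : {n : ℕ} → Vec K3 n → ℕ
vE {zero} [] = 0
vE {suc m} ks with last ks
... | k1 = 4 * m + 1
... | k2 = 4 * m + 2
... | k3 = 4 * m + 3

vF : {n : ℕ} → Vec K3 n → ℕ
vF {zero} [] = 0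
vF {suc m} ks with last ks
... | k1 = 4 * m + 2
... | k2 = 4 * m + 3
... | k3 = 4 * m

-- Cut the graph along a rung uw shared by two consecutive hexagons. A matching of the glued graph
-- is a matching on each side, and the sides interact only through whether u and w are covered: an
-- endpoint covered on one side behaves as deleted on the other. Grouping the maximal matchings of
-- each side by these cover states, the nine counts Ψ_xy of the chain starting at hexagon j are
-- f(M_j) applied to those of the chain starting at hexagon j + 1, the coefficients being read off
-- by enumerating the matchings of one hexagon. The last two hexagons, glued to K along dc, carry
-- the forbidden items; enumerating them gives (f(M_{n−1}) f(M_n))[i, 9] times the number of
-- maximal matchings of K covering c.

module Submission where

open import Defs
open import Data.Bool using (Bool; true; false; _∧_; _∨_; not; if_then_else_; T)
open import Data.Bool.Properties using (∨-comm; ∧-comm; ∨-identityʳ; ∧-identityʳ; ∧-zeroʳ; ∨-idem)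
open import Data.Bool.ListAction using (all; any)
open import Data.Empty using (⊥; ⊥-elim)
open import Data.Fin using (Fin; zero; suc; fromℕ)
open import Data.List using (List; []; _∷_; _++_; map; filterᵇ; upTo; applyUpTo; length; allFin)
open import Data.List.Membership.Propositional using (_∈_)
open import Data.List.Membership.Propositional.Properties using (∈-++⁺ˡ; ∈-++⁺ʳ; ∈-map⁺; ∈-++⁻; ∈-allFin)
open import Data.List.Properties using (map-++; map-∘; ++-identityʳ; ++-assoc; length-++)
open import Data.List.Relation.Binary.Sublist.Propositional using (_⊆_; []; _∷_; _∷ʳ_) renaming (lookup to ⊆-lookup)
open import Data.List.Relation.Unary.Any using (here; there)
open import Data.Nat using (ℕ; zero; suc; _+_; _*_; _≡ᵇ_; _≤_; _<_; _≤ᵇ_; z≤n; s≤s)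
open import Data.Nat.ListAction using (sum)
open import Data.Nat.ListAction.Properties using (sum-++)
open import Data.Nat.Properties
  using (*-assoc; *-distribʳ-+; *-distribˡ-+; +-cancelˡ-≡; +-cancelˡ-≤; +-identityʳ; +-monoʳ-<; +-monoʳ-≤; +-suc;
         <⇒≢; <⇒≤; <⇒≱; m≤m+n; ≡ᵇ⇒≡; ≡⇒≡ᵇ; ≤-reflexive; ≤-trans; ≤ᵇ⇒≤)
open import Data.Nat.Tactic.RingSolver using (solve-∀)
open import Data.Product using (Σ; _×_; _,_; proj₁; proj₂)
open import Data.Sum using (_⊎_; inj₁; inj₂; [_,_])
open import Data.Unit using (tt)
open import Data.Vec using (Vec; []; _∷_; toList; last; lookup)
open import Function using (_∘_; id)
open import Function.Bundles using (_⇔_; Equivalence)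
open import Relation.Binary.PropositionalEquality using (_≡_; refl; sym; trans; cong; cong₂; subst)
open Relation.Binary.PropositionalEquality.≡-Reasoning

-- Boolean identities by truth tables

data Formula : Set where
  #_ : ℕ → Formula
  ⊤ᶠ ⊥ᶠ : Formula
  _∧ᶠ_ _∨ᶠ_ : Formula → Formula → Formula
  ¬ᶠ_ : Formula → Formula

infix 9 #_
infix 8 ¬ᶠ_
infixr 6 _∧ᶠ_
infixr 5 _∨ᶠ_

lookupᵇ : ℕ → List Bool → Bool
lookupᵇ _ [] = false
lookupᵇ zero (b ∷ _) = b
lookupᵇ (suc i) (_ ∷ bs) = lookupᵇ i bs

⟦_⟧ : Formula → List Bool → Bool
⟦ # i ⟧ ρ = lookupᵇ i ρ
⟦ ⊤ᶠ ⟧ ρ = true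
⟦ ⊥ᶠ ⟧ ρ = false
⟦ f ∧ᶠ g ⟧ ρ = ⟦ f ⟧ ρ ∧ ⟦ g ⟧ ρ
⟦ f ∨ᶠ g ⟧ ρ = ⟦ f ⟧ ρ ∨ ⟦ g ⟧ ρ
⟦ ¬ᶠ f ⟧ ρ = not (⟦ f ⟧ ρ)

T-∧-proj₁ : ∀ {a b} → T (a ∧ b) → T a
T-∧-proj₁ {true} _ = tt

T-∧-proj₂ : ∀ {a b} → T (a ∧ b) → T b
T-∧-proj₂ {true} h = h

T-∧-intro : ∀ {a b} → T a → T b → T (a ∧ b)
T-∧-intro {true} _ h = h

T-∨-elim : ∀ {a b} → T (a ∨ b) → T a ⊎ T b
T-∨-elim {true} _ = inj₁ tt
T-∨-elim {false} h = inj₂ h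

T-∨-inj₁ : ∀ {a b} → T a → T (a ∨ b)
T-∨-inj₁ {true} _ = tt

T-∨-inj₂ : ∀ {a b} → T b → T (a ∨ b)
T-∨-inj₂ {true} _ = tt
T-∨-inj₂ {false} h = h

T-not-elim : ∀ {a} → T (not a) → T a → ⊥
T-not-elim {false} _ ()

T-not-intro : ∀ {a} → (T a → ⊥) → T (not a)
T-not-intro {true} h = h tt
T-not-intro {false} _ = tt

≡true⇒T : ∀ {a} → a ≡ true → T a
≡true⇒T refl = tt

¬T⇒≡false : ∀ {a} → (T a → ⊥) → a ≡ false
¬T⇒≡false {true} h = ⊥-elim (h tt)
¬T⇒≡false {false} _ = refl

T-ext : ∀ {a b} → (T a → T b) → (T b → T a) → a ≡ b
T-ext {true} {true} _ _ = refl
T-ext {true} {false} f _ = ⊥-elim (f tt)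
T-ext {false} {true} _ g = ⊥-elim (g tt)
T-ext {false} {false} _ _ = refl

everyAssignment : ℕ → (List Bool → Bool) → Bool
everyAssignment zero f = f []
everyAssignment (suc k) f =
  everyAssignment k (λ ρ → f (true ∷ ρ)) ∧ everyAssignment k (λ ρ → f (false ∷ ρ))

everyAssignment-sound : ∀ k f → T (everyAssignment k f) → (ρ : Vec Bool k) → T (f (toList ρ))
everyAssignment-sound zero f h [] = h
everyAssignment-sound (suc k) f h (true ∷ ρ) =
  everyAssignment-sound k (λ ρ → f (true ∷ ρ)) (T-∧-proj₁ h) ρ
everyAssignment-sound (suc k) f h (false ∷ ρ) =
  everyAssignment-sound k (λ ρ → f (false ∷ ρ)) (T-∧-proj₂ {everyAssignment k (λ ρ → f (true ∷ ρ))} h) ρ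

_==_ : Bool → Bool → Bool
true == b = b
false == b = not b

==-sound : ∀ a b → T (a == b) → a ≡ b
==-sound true true _ = refl
==-sound false false _ = refl

by-truth-table : ∀ k φ ψ → T (everyAssignment k (λ ρ → ⟦ φ ⟧ ρ == ⟦ ψ ⟧ ρ)) →
                 (ρ : Vec Bool k) → ⟦ φ ⟧ (toList ρ) ≡ ⟦ ψ ⟧ (toList ρ)
by-truth-table k φ ψ h ρ = ==-sound _ _ (everyAssignment-sound k _ h ρ)

≡ᵇ-refl : ∀ n → T (n ≡ᵇ n)
≡ᵇ-refl n = ≡⇒≡ᵇ n n refl

≡ᵇ-sym : ∀ m n → (m ≡ᵇ n) ≡ (n ≡ᵇ m)
≡ᵇ-sym zero zero = refl
≡ᵇ-sym zero (suc n) = refl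
≡ᵇ-sym (suc m) zero = refl
≡ᵇ-sym (suc m) (suc n) = ≡ᵇ-sym m n

T-≡ᵇ : ∀ {a b} → T (a ≡ᵇ b) → a ≡ b
T-≡ᵇ {a} {b} = ≡ᵇ⇒≡ a b

T-any : ∀ {A : Set} (f : A → Bool) xs → T (any f xs) → Σ A (λ x → x ∈ xs × T (f x))
T-any f (x ∷ xs) h with T-∨-elim {f x} h
... | inj₁ p = x , here refl , p
... | inj₂ p with T-any f xs p
... | y , y∈ , q = y , there y∈ , q

any-T : ∀ {A : Set} (f : A → Bool) {xs x} → x ∈ xs → T (f x) → T (any f xs)
any-T f (here refl) h = T-∨-inj₁ h
any-T f {y ∷ xs} (there x∈) h = T-∨-inj₂ {f y} (any-T f x∈ h)

T-all : ∀ {A : Set} (f : A → Bool) {xs x} → T (all f xs) → x ∈ xs → T (f x)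
T-all f h (here refl) = T-∧-proj₁ h
T-all f {y ∷ xs} h (there x∈) = T-all f (T-∧-proj₂ {f y} h) x∈

all-T : ∀ {A : Set} (f : A → Bool) xs → (∀ x → x ∈ xs → T (f x)) → T (all f xs)
all-T f [] h = tt
all-T f (x ∷ xs) h = T-∧-intro (h x (here refl)) (all-T f xs (λ y y∈ → h y (there y∈)))

all-cong : ∀ {A : Set} (f g : A → Bool) xs → (∀ x → x ∈ xs → f x ≡ g x) → all f xs ≡ all g xs
all-cong f g [] h = refl
all-cong f g (x ∷ xs) h = cong₂ _∧_ (h x (here refl)) (all-cong f g xs (λ y y∈ → h y (there y∈)))

any-cong : ∀ {A : Set} (f g : A → Bool) xs → (∀ x → f x ≡ g x) → any f xs ≡ any g xs
any-cong f g [] h = refl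
any-cong f g (x ∷ xs) h = cong₂ _∨_ (h x) (any-cong f g xs h)

all-++ : ∀ {A : Set} (f : A → Bool) xs ys → all f (xs ++ ys) ≡ (all f xs ∧ all f ys)
all-++ f [] ys = refl
all-++ f (x ∷ xs) ys rewrite all-++ f xs ys with f x
... | true = refl
... | false = refl

any-++ : ∀ {A : Set} (f : A → Bool) xs ys → any f (xs ++ ys) ≡ (any f xs ∨ any f ys)
any-++ f [] ys = refl
any-++ f (x ∷ xs) ys rewrite any-++ f xs ys with f x
... | true = refl
... | false = refl

all-map : ∀ {A B : Set} (f : B → Bool) (g : A → B) xs → all f (map g xs) ≡ all (f ∘ g) xs
all-map f g [] = refl
all-map f g (x ∷ xs) = cong (f (g x) ∧_) (all-map f g xs)

any-map : ∀ {A B : Set} (f : B → Bool) (g : A → B) xs → any f (map g xs) ≡ any (f ∘ g) xs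
any-map f g [] = refl
any-map f g (x ∷ xs) = cong (f (g x) ∨_) (any-map f g xs)

all-filterᵇ : ∀ {A : Set} (p q : A → Bool) xs → all p (filterᵇ q xs) ≡ all (λ x → not (q x) ∨ p x) xs
all-filterᵇ p q [] = refl
all-filterᵇ p q (x ∷ xs) with q x
... | true = cong (p x ∧_) (all-filterᵇ p q xs)
... | false = all-filterᵇ p q xs

∑ᵇ : (Bool → ℕ) → ℕ
∑ᵇ f = f true + f false

∑ᵇ-cong : ∀ {f g : Bool → ℕ} → (∀ b → f b ≡ g b) → ∑ᵇ f ≡ ∑ᵇ g
∑ᵇ-cong h = cong₂ _+_ (h true) (h false)

sum-map-cong : ∀ {A : Set} (f g : A → ℕ) xs → (∀ x → f x ≡ g x) → sum (map f xs) ≡ sum (map g xs)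
sum-map-cong f g [] h = refl
sum-map-cong f g (x ∷ xs) h = cong₂ _+_ (h x) (sum-map-cong f g xs h)

sum-map-map : ∀ {A B : Set} (f : B → ℕ) (g : A → B) xs → sum (map f (map g xs)) ≡ sum (map (f ∘ g) xs)
sum-map-map f g xs = cong sum (sym (map-∘ xs))

count-++ : ∀ {A : Set} (p : A → Bool) xs ys → count p (xs ++ ys) ≡ count p xs + count p ys
count-++ p [] ys = refl
count-++ p (x ∷ xs) ys with p x
... | true = cong suc (count-++ p xs ys)
... | false = count-++ p xs ys

count-map : ∀ {A B : Set} (p : B → Bool) (f : A → B) xs → count p (map f xs) ≡ count (p ∘ f) xs
count-map p f [] = refl
count-map p f (x ∷ xs) with p (f x)
... | true = cong suc (count-map p f xs)
... | false = count-map p f xs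

count-cong : ∀ {A : Set} (p q : A → Bool) xs → (∀ x → p x ≡ q x) → count p xs ≡ count q xs
count-cong p q [] h = refl
count-cong p q (x ∷ xs) h rewrite h x with q x
... | true = cong suc (count-cong p q xs h)
... | false = count-cong p q xs h

count-false : ∀ {A : Set} (p : A → Bool) xs → (∀ x → p x ≡ false) → count p xs ≡ 0
count-false p [] h = refl
count-false p (x ∷ xs) h rewrite h x = count-false p xs h

count-guard : ∀ {A : Set} c (q : A → Bool) xs → count (λ x → c ∧ q x) xs ≡ (if c then count q xs else 0)
count-guard true q xs = refl
count-guard false q xs = count-false _ xs (λ _ → refl)

count-split : ∀ {A : Set} (p q : A → Bool) xs → count p xs ≡ ∑ᵇ (λ b → count (λ x → p x ∧ (q x == b)) xs)
count-split p q [] = refl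
count-split p q (x ∷ xs) with p x | q x
... | false | _ = count-split p q xs
... | true | true = cong suc (count-split p q xs)
... | true | false = trans (cong suc (count-split p q xs)) (sym (+-suc _ _))

count-sublists-∷ : ∀ {A : Set} (p : List A → Bool) x L →
  count p (sublists (x ∷ L)) ≡ count p (sublists L) + count (p ∘ (x ∷_)) (sublists L)
count-sublists-∷ p x L =
  trans (count-++ p (sublists L) (map (x ∷_) (sublists L)))
        (cong (count p (sublists L) +_) (count-map p (x ∷_) (sublists L)))

sum-sublists-∷ : ∀ {A : Set} (f : List A → ℕ) x L →
  sum (map f (sublists (x ∷ L))) ≡ sum (map f (sublists L)) + sum (map (f ∘ (x ∷_)) (sublists L))
sum-sublists-∷ f x L =
  trans (cong sum (map-++ f (sublists L) (map (x ∷_) (sublists L))))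
        (trans (sum-++ (map f (sublists L)) (map f (map (x ∷_) (sublists L))))
               (cong (sum (map f (sublists L)) +_) (sum-map-map f (x ∷_) (sublists L))))

count-sublists-cong : ∀ {A : Set} (p q : List A → Bool) L → (∀ m → m ⊆ L → p m ≡ q m) →
  count p (sublists L) ≡ count q (sublists L)
count-sublists-cong p q [] h rewrite h [] [] = refl
count-sublists-cong p q (x ∷ L) h =
  trans (count-sublists-∷ p x L)
   (trans (cong₂ _+_ (count-sublists-cong p q L (λ m s → h m (x ∷ʳ s)))
                     (count-sublists-cong (p ∘ (x ∷_)) (q ∘ (x ∷_)) L (λ m s → h (x ∷ m) (refl ∷ s))))
          (sym (count-sublists-∷ q x L)))

sum-sublists-cong : ∀ {A : Set} (f g : List A → ℕ) L → (∀ m → m ⊆ L → f m ≡ g m) →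
  sum (map f (sublists L)) ≡ sum (map g (sublists L))
sum-sublists-cong f g [] h = cong (_+ 0) (h [] [])
sum-sublists-cong f g (x ∷ L) h =
  trans (sum-sublists-∷ f x L)
   (trans (cong₂ _+_ (sum-sublists-cong f g L (λ m s → h m (x ∷ʳ s)))
                     (sum-sublists-cong (f ∘ (x ∷_)) (g ∘ (x ∷_)) L (λ m s → h (x ∷ m) (refl ∷ s))))
          (sym (sum-sublists-∷ g x L)))

-- A sublist of L₁ ++ L₂ is a sublist of L₁ followed by a sublist of L₂.
count-sublists-++ : ∀ {A : Set} (p : List A → Bool) L₁ L₂ →
  count p (sublists (L₁ ++ L₂)) ≡ sum (map (λ m₁ → count (λ m₂ → p (m₁ ++ m₂)) (sublists L₂)) (sublists L₁))
count-sublists-++ p [] L₂ = sym (+-identityʳ _)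
count-sublists-++ p (x ∷ L₁) L₂ =
  trans (count-sublists-∷ p x (L₁ ++ L₂))
   (trans (cong₂ _+_ (count-sublists-++ p L₁ L₂) (count-sublists-++ (p ∘ (x ∷_)) L₁ L₂))
     (sym (sum-sublists-∷ (λ m₁ → count (λ m₂ → p (m₁ ++ m₂)) (sublists L₂)) x L₁)))

⊆⇒∈-sublists : ∀ {A : Set} {m L : List A} → m ⊆ L → m ∈ sublists L
⊆⇒∈-sublists [] = here refl
⊆⇒∈-sublists (x ∷ʳ s) = ∈-++⁺ˡ (⊆⇒∈-sublists s)
⊆⇒∈-sublists {L = x ∷ L} (refl ∷ s) = ∈-++⁺ʳ (sublists L) (∈-map⁺ (x ∷_) (⊆⇒∈-sublists s))

all-sublists : ∀ {A : Set} (f : List A → Bool) L → (∀ m → m ⊆ L → T (f m)) → T (all f (sublists L))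
all-sublists f [] h = T-∧-intro (h [] []) tt
all-sublists f (x ∷ L) h
  rewrite all-++ f (sublists L) (map (x ∷_) (sublists L)) | all-map f (x ∷_) (sublists L) =
  T-∧-intro (all-sublists f L (λ m s → h m (x ∷ʳ s)))
            (all-sublists (f ∘ (x ∷_)) L (λ m s → h (x ∷ m) (refl ∷ s)))

-- Equality of edge lists up to the order of the edges and their orientation.
infix 4 _↭ᴱ_
data _↭ᴱ_ : List Edge → List Edge → Set where
  ↭ᴱ-refl : ∀ {L} → L ↭ᴱ L
  ↭ᴱ-trans : ∀ {L L′ L″} → L ↭ᴱ L′ → L′ ↭ᴱ L″ → L ↭ᴱ L″
  prep : ∀ {L L′} e → L ↭ᴱ L′ → (e ∷ L) ↭ᴱ (e ∷ L′)
  swap : ∀ e g L → (e ∷ g ∷ L) ↭ᴱ (g ∷ e ∷ L)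
  flip : ∀ a b L → ((a , b) ∷ L) ↭ᴱ ((b , a) ∷ L)

↭ᴱ-sym : ∀ {L L′} → L ↭ᴱ L′ → L′ ↭ᴱ L
↭ᴱ-sym ↭ᴱ-refl = ↭ᴱ-refl
↭ᴱ-sym (↭ᴱ-trans r r′) = ↭ᴱ-trans (↭ᴱ-sym r′) (↭ᴱ-sym r)
↭ᴱ-sym (prep e r) = prep e (↭ᴱ-sym r)
↭ᴱ-sym (swap e g L) = swap g e L
↭ᴱ-sym (flip a b L) = flip b a L

↭ᴱ-reflexive : ∀ {L L′} → L ≡ L′ → L ↭ᴱ L′
↭ᴱ-reflexive refl = ↭ᴱ-refl

↭ᴱ-++ˡ : ∀ P {L L′} → L ↭ᴱ L′ → (P ++ L) ↭ᴱ (P ++ L′)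
↭ᴱ-++ˡ [] r = r
↭ᴱ-++ˡ (e ∷ P) r = prep e (↭ᴱ-++ˡ P r)

↭ᴱ-shift : ∀ e P L → (e ∷ P ++ L) ↭ᴱ (P ++ e ∷ L)
↭ᴱ-shift e [] L = ↭ᴱ-refl
↭ᴱ-shift e (g ∷ P) L = ↭ᴱ-trans (swap e g (P ++ L)) (prep g (↭ᴱ-shift e P L))

Respects↭ᴱ : (List Edge → Bool) → Set
Respects↭ᴱ p = ∀ {m m′} → m ↭ᴱ m′ → p m ≡ p m′

FlipInvariant : (Edge → Bool) → Set
FlipInvariant f = ∀ a b → f (a , b) ≡ f (b , a)

count-sublists-↭ᴱ : ∀ (p : List Edge → Bool) → Respects↭ᴱ p → ∀ {L L′} → L ↭ᴱ L′ →
  count p (sublists L) ≡ count p (sublists L′)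
count-sublists-↭ᴱ p rp ↭ᴱ-refl = refl
count-sublists-↭ᴱ p rp (↭ᴱ-trans r r′) = trans (count-sublists-↭ᴱ p rp r) (count-sublists-↭ᴱ p rp r′)
count-sublists-↭ᴱ p rp (prep {L} {L′} e r) =
  trans (count-sublists-∷ p e L)
   (trans (cong₂ _+_ (count-sublists-↭ᴱ p rp r) (count-sublists-↭ᴱ (p ∘ (e ∷_)) (rp ∘ prep e) r))
          (sym (count-sublists-∷ p e L′)))
count-sublists-↭ᴱ p rp (swap e g L) =
  begin
    count p (sublists (e ∷ g ∷ L))
  ≡⟨ count-sublists-∷ p e (g ∷ L) ⟩
    count p (sublists (g ∷ L)) + count (p ∘ (e ∷_)) (sublists (g ∷ L))
  ≡⟨ cong₂ _+_ (count-sublists-∷ p g L) (count-sublists-∷ (p ∘ (e ∷_)) g L) ⟩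
    (n + nᵍ) + (nᵉ + count (λ m → p (e ∷ g ∷ m)) (sublists L))
  ≡⟨ cong (λ z → (n + nᵍ) + (nᵉ + z)) (count-cong _ _ (sublists L) (λ m → rp (swap e g m))) ⟩
    (n + nᵍ) + (nᵉ + count (λ m → p (g ∷ e ∷ m)) (sublists L))
  ≡⟨ +-interchange n nᵍ nᵉ _ ⟩
    (n + nᵉ) + (nᵍ + count (λ m → p (g ∷ e ∷ m)) (sublists L))
  ≡⟨ sym (cong₂ _+_ (count-sublists-∷ p e L) (count-sublists-∷ (p ∘ (g ∷_)) e L)) ⟩
    count p (sublists (e ∷ L)) + count (p ∘ (g ∷_)) (sublists (e ∷ L))
  ≡⟨ sym (count-sublists-∷ p g (e ∷ L)) ⟩
    count p (sublists (g ∷ e ∷ L))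
  ∎
  where
  n = count p (sublists L)
  nᵉ = count (p ∘ (e ∷_)) (sublists L)
  nᵍ = count (p ∘ (g ∷_)) (sublists L)
  +-interchange : ∀ a b c d → (a + b) + (c + d) ≡ (a + c) + (b + d)
  +-interchange = solve-∀
count-sublists-↭ᴱ p rp (flip a b L) =
  trans (count-sublists-∷ p (a , b) L)
   (trans (cong (count p (sublists L) +_) (count-cong _ _ (sublists L) (λ m → rp (flip a b m))))
          (sym (count-sublists-∷ p (b , a) L)))

all-↭ᴱ : ∀ f → FlipInvariant f → Respects↭ᴱ (all f)
all-↭ᴱ f fi ↭ᴱ-refl = refl
all-↭ᴱ f fi (↭ᴱ-trans r r′) = trans (all-↭ᴱ f fi r) (all-↭ᴱ f fi r′)
all-↭ᴱ f fi (prep e r) = cong (f e ∧_) (all-↭ᴱ f fi r)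
all-↭ᴱ f fi (swap e g L) =
  by-truth-table 3 (# 0 ∧ᶠ # 1 ∧ᶠ # 2) (# 1 ∧ᶠ # 0 ∧ᶠ # 2) tt (f e ∷ f g ∷ all f L ∷ [])
all-↭ᴱ f fi (flip a b L) = cong (_∧ all f L) (fi a b)

any-↭ᴱ : ∀ f → FlipInvariant f → Respects↭ᴱ (any f)
any-↭ᴱ f fi ↭ᴱ-refl = refl
any-↭ᴱ f fi (↭ᴱ-trans r r′) = trans (any-↭ᴱ f fi r) (any-↭ᴱ f fi r′)
any-↭ᴱ f fi (prep e r) = cong (f e ∨_) (any-↭ᴱ f fi r)
any-↭ᴱ f fi (swap e g L) =
  by-truth-table 3 (# 0 ∨ᶠ # 1 ∨ᶠ # 2) (# 1 ∨ᶠ # 0 ∨ᶠ # 2) tt (f e ∷ f g ∷ any f L ∷ [])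
any-↭ᴱ f fi (flip a b L) = cong (_∨ any f L) (fi a b)

-- Maximal matchings

incident-flip : ∀ u → FlipInvariant (incident u)
incident-flip u a b = ∨-comm (u ≡ᵇ a) (u ≡ᵇ b)

incident-fst : ∀ a b → T (incident a (a , b))
incident-fst a b = T-∨-inj₁ (≡ᵇ-refl a)

incident-snd : ∀ a b → T (incident b (a , b))
incident-snd a b = T-∨-inj₂ {b ≡ᵇ a} (≡ᵇ-refl b)

sameEdge-flip : ∀ e → FlipInvariant (sameEdge e)
sameEdge-flip (u , w) a b = ∨-comm ((u ≡ᵇ a) ∧ (w ≡ᵇ b)) ((u ≡ᵇ b) ∧ (w ≡ᵇ a))

sameEdge-flipˡ : ∀ a b g → sameEdge (a , b) g ≡ sameEdge (b , a) g
sameEdge-flipˡ a b (c , d) =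
  by-truth-table 4 ((# 0 ∧ᶠ # 1) ∨ᶠ (# 2 ∧ᶠ # 3)) ((# 3 ∧ᶠ # 2) ∨ᶠ (# 1 ∧ᶠ # 0)) tt
    ((a ≡ᵇ c) ∷ (b ≡ᵇ d) ∷ (a ≡ᵇ d) ∷ (b ≡ᵇ c) ∷ [])

sameEdge-cases : ∀ {a b c d} → T (sameEdge (a , b) (c , d)) → ((a ≡ c) × (b ≡ d)) ⊎ ((a ≡ d) × (b ≡ c))
sameEdge-cases {a} {b} {c} {d} h with T-∨-elim {(a ≡ᵇ c) ∧ (b ≡ᵇ d)} h
... | inj₁ p = inj₁ (T-≡ᵇ (T-∧-proj₁ p) , T-≡ᵇ (T-∧-proj₂ {a ≡ᵇ c} p))
... | inj₂ p = inj₂ (T-≡ᵇ (T-∧-proj₁ p) , T-≡ᵇ (T-∧-proj₂ {a ≡ᵇ d} p))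

sameEdge-refl : ∀ e → T (sameEdge e e)
sameEdge-refl (a , b) = T-∨-inj₁ (T-∧-intro (≡ᵇ-refl a) (≡ᵇ-refl b))

sameEdge-sym : ∀ e g → sameEdge e g ≡ sameEdge g e
sameEdge-sym (a , b) (c , d) rewrite ≡ᵇ-sym a c | ≡ᵇ-sym b d | ≡ᵇ-sym a d | ≡ᵇ-sym b c =
  by-truth-table 4 ((# 0 ∧ᶠ # 1) ∨ᶠ (# 2 ∧ᶠ # 3)) ((# 0 ∧ᶠ # 1) ∨ᶠ (# 3 ∧ᶠ # 2)) tt
    ((c ≡ᵇ a) ∷ (d ≡ᵇ b) ∷ (d ≡ᵇ a) ∷ (c ≡ᵇ b) ∷ [])

sameEdge-incident : ∀ {g h} p → T (sameEdge g h) → T (incident p g) → T (incident p h)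
sameEdge-incident {a , b} {c , d} p s i with sameEdge-cases {a} {b} {c} {d} s
... | inj₁ (refl , refl) = i
... | inj₂ (refl , refl) rewrite incident-flip p b a = i

memE-flip : ∀ M → FlipInvariant (λ g → memE g M)
memE-flip M a b = any-cong _ _ M (sameEdge-flipˡ a b)

∈⇒memE : ∀ {g M} → g ∈ M → T (memE g M)
∈⇒memE {g} g∈ = any-T (sameEdge g) g∈ (sameEdge-refl g)

memE⇒covers : ∀ {m} a b → T (memE (a , b) m) → T (covers m a)
memE⇒covers {m} a b h with T-any (sameEdge (a , b)) m h
... | g , g∈ , s = any-T (incident a) g∈ (sameEdge-incident a s (incident-fst a b))

covers-↭ᴱ : ∀ u → Respects↭ᴱ (λ m → covers m u)
covers-↭ᴱ u = any-↭ᴱ (incident u) (incident-flip u)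

memE-↭ᴱ : ∀ e → Respects↭ᴱ (memE e)
memE-↭ᴱ e = any-↭ᴱ (sameEdge e) (sameEdge-flip e)

disjointE-flip : ∀ e → FlipInvariant (disjointE e)
disjointE-flip (u , w) a b = cong₂ _∧_ (cong not (incident-flip u a b)) (cong not (incident-flip w a b))

disjointE-flipˡ : ∀ a b e → disjointE (a , b) e ≡ disjointE (b , a) e
disjointE-flipˡ a b e = ∧-comm (not (incident a e)) (not (incident b e))

disjointE-sym : ∀ e g → disjointE e g ≡ disjointE g e
disjointE-sym (u , w) (a , b) rewrite ≡ᵇ-sym u a | ≡ᵇ-sym u b | ≡ᵇ-sym w a | ≡ᵇ-sym w b =
  by-truth-table 4 (¬ᶠ (# 0 ∨ᶠ # 1) ∧ᶠ ¬ᶠ (# 2 ∨ᶠ # 3)) (¬ᶠ (# 0 ∨ᶠ # 2) ∧ᶠ ¬ᶠ (# 1 ∨ᶠ # 3)) tt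
    ((a ≡ᵇ u) ∷ (b ≡ᵇ u) ∷ (a ≡ᵇ w) ∷ (b ≡ᵇ w) ∷ [])

isMatching-↭ᴱ : Respects↭ᴱ isMatching
isMatching-↭ᴱ ↭ᴱ-refl = refl
isMatching-↭ᴱ (↭ᴱ-trans r r′) = trans (isMatching-↭ᴱ r) (isMatching-↭ᴱ r′)
isMatching-↭ᴱ (prep e r) = cong₂ _∧_ (all-↭ᴱ (disjointE e) (disjointE-flip e) r) (isMatching-↭ᴱ r)
isMatching-↭ᴱ (swap e g L) rewrite disjointE-sym e g =
  by-truth-table 4 ((# 0 ∧ᶠ # 1) ∧ᶠ (# 2 ∧ᶠ # 3)) ((# 0 ∧ᶠ # 2) ∧ᶠ (# 1 ∧ᶠ # 3)) tt
    (disjointE g e ∷ all (disjointE e) L ∷ all (disjointE g) L ∷ isMatching L ∷ [])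
isMatching-↭ᴱ (flip a b L) = cong (_∧ isMatching L) (all-cong _ _ L (λ e _ → disjointE-flipˡ a b e))

touches : List Edge → Edge → Bool
touches m (a , b) = covers m a ∨ covers m b

touches-flip : ∀ m → FlipInvariant (touches m)
touches-flip m a b = ∨-comm (covers m a) (covers m b)

touches-↭ᴱ : ∀ e → Respects↭ᴱ (λ m → touches m e)
touches-↭ᴱ (a , b) r = cong₂ _∨_ (covers-↭ᴱ a r) (covers-↭ᴱ b r)

∈⇒touches : ∀ {e m} → e ∈ m → T (touches m e)
∈⇒touches {a , b} {m} e∈ = T-∨-inj₁ (any-T (incident a) e∈ (incident-fst a b))

all-disjointE : ∀ a b m → all (disjointE (a , b)) m ≡ not (touches m (a , b))
all-disjointE a b [] = refl
all-disjointE a b (g ∷ m) rewrite all-disjointE a b m =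
  by-truth-table 4 ((¬ᶠ # 0 ∧ᶠ ¬ᶠ # 1) ∧ᶠ ¬ᶠ (# 2 ∨ᶠ # 3)) (¬ᶠ ((# 0 ∨ᶠ # 2) ∨ᶠ (# 1 ∨ᶠ # 3))) tt
    (incident a g ∷ incident b g ∷ covers m a ∷ covers m b ∷ [])

disjointE-no-common : ∀ {e h} p → T (disjointE e h) → T (incident p e) → T (incident p h) → ⊥
disjointE-no-common {u , w} {h} p d ie ih with T-∨-elim {p ≡ᵇ u} ie
... | inj₁ q rewrite T-≡ᵇ {p} {u} q = T-not-elim (T-∧-proj₁ d) ih
... | inj₂ q rewrite T-≡ᵇ {p} {w} q = T-not-elim (T-∧-proj₂ {not (incident u h)} d) ih

matching-common-vertex : ∀ m {e h} p → T (isMatching m) → e ∈ m → h ∈ m →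
  T (incident p e) → T (incident p h) → e ≡ h
matching-common-vertex (x ∷ m) p im (here refl) (here refl) ie ih = refl
matching-common-vertex (x ∷ m) p im (here refl) (there h∈) ie ih =
  ⊥-elim (disjointE-no-common p (T-all (disjointE x) (T-∧-proj₁ im) h∈) ie ih)
matching-common-vertex (x ∷ m) p im (there e∈) (here refl) ie ih =
  ⊥-elim (disjointE-no-common p (T-all (disjointE x) (T-∧-proj₁ im) e∈) ih ie)
matching-common-vertex (x ∷ m) p im (there e∈) (there h∈) ie ih =
  matching-common-vertex m p (T-∧-proj₂ {all (disjointE x) m} im) e∈ h∈ ie ih

insert-⊆ : ∀ {m L e} → m ⊆ L → e ∈ L → e ∈ m ⊎ Σ (List Edge) (λ m′ → m′ ⊆ L × (m′ ↭ᴱ e ∷ m))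
insert-⊆ (x ∷ʳ s) (here refl) = inj₂ (x ∷ _ , refl ∷ s , ↭ᴱ-refl)
insert-⊆ (x ∷ʳ s) (there e∈) with insert-⊆ s e∈
... | inj₁ p = inj₁ p
... | inj₂ (m′ , s′ , r) = inj₂ (m′ , x ∷ʳ s′ , r)
insert-⊆ (refl ∷ s) (here refl) = inj₁ (here refl)
insert-⊆ (refl ∷ s) (there e∈) with insert-⊆ s e∈
... | inj₁ p = inj₁ (there p)
... | inj₂ (m′ , s′ , r) = inj₂ (_ ∷ m′ , refl ∷ s′ , ↭ᴱ-trans (prep _ r) (swap _ _ _))

notLarger : List Edge → List Edge → Bool
notLarger m m′ = not (isMatching m′ ∧ subsetE m m′) ∨ subsetE m′ m

dominating⇒maximal : ∀ m L → T (all (touches m) L) → ∀ m′ → m′ ⊆ L → T (notLarger m m′)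
dominating⇒maximal m L dom m′ s′ with isMatching m′ ∧ subsetE m m′ in eq
... | false = tt
... | true = all-T (λ g → memE g m) m′ m′⊆m
  where
  im′ : T (isMatching m′)
  im′ = T-∧-proj₁ (subst T (sym eq) tt)
  m⊆m′ : T (subsetE m m′)
  m⊆m′ = T-∧-proj₂ {isMatching m′} (subst T (sym eq) tt)
  -- an edge of m′ sharing the vertex p with an edge of m ⊆ m′ is that edge
  via : ∀ {e} p → e ∈ m′ → T (incident p e) → T (covers m p) → T (memE e m)
  via {e} p e∈ ie cp with T-any (incident p) m cp
  ... | g , g∈ , ig with T-any (sameEdge g) m′ (T-all (λ g → memE g m′) m⊆m′ g∈)
  ... | h , h∈ , sgh with matching-common-vertex m′ p im′ e∈ h∈ ie (sameEdge-incident p sgh ig)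
  ... | refl = any-T (sameEdge e) g∈ (subst T (sameEdge-sym g e) sgh)
  m′⊆m : ∀ g → g ∈ m′ → T (memE g m)
  m′⊆m (p , q) g∈ with T-∨-elim {covers m p} (T-all (touches m) dom (⊆-lookup s′ g∈))
  ... | inj₁ cp = via p g∈ (incident-fst p q) cp
  ... | inj₂ cq = via q g∈ (incident-snd p q) cq

maximal⇒dominating : ∀ m L → m ⊆ L → T (isMatching m) → T (all (notLarger m) (sublists L)) →
  ∀ e → e ∈ L → T (touches m e)
maximal⇒dominating m L s im max (a , b) e∈ with touches m (a , b) in eq
... | true = tt
... | false with insert-⊆ s e∈
... | inj₁ e∈m = subst T eq (∈⇒touches e∈m)
... | inj₂ (m′ , s′ , r) = ⊥-elim (subst T eq touched)
  where
  untouched : T (not (touches m (a , b)))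
  untouched = subst T (cong not (sym eq)) tt
  im′ : T (isMatching m′)
  im′ = subst T (sym (isMatching-↭ᴱ r)) (T-∧-intro (subst T (sym (all-disjointE a b m)) untouched) im)
  m⊆m′ : T (subsetE m m′)
  m⊆m′ = all-T (λ g → memE g m′) m (λ g g∈ → subst T (sym (memE-↭ᴱ g r)) (∈⇒memE (there g∈)))
  m′⊆m : T (subsetE m′ m)
  m′⊆m with T-∨-elim {not (isMatching m′ ∧ subsetE m m′)} (T-all (notLarger m) max (⊆⇒∈-sublists s′))
  ... | inj₁ h = ⊥-elim (T-not-elim h (T-∧-intro im′ m⊆m′))
  ... | inj₂ h = h
  touched : T (touches m (a , b))
  touched = T-∨-inj₁ (memE⇒covers {m} a b
    (T-∧-proj₁ {memE (a , b) m} (subst T (all-↭ᴱ (λ g → memE g m) (memE-flip m) r) m′⊆m)))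

isMaximalMatching-dominating : ∀ X m → m ⊆ E X →
  isMaximalMatching X m ≡ (isMatching m ∧ all (touches m) (E X))
isMaximalMatching-dominating X m s = T-ext
  (λ h → T-∧-intro (T-∧-proj₁ h)
    (all-T _ (E X) (maximal⇒dominating m (E X) s (T-∧-proj₁ h) (T-∧-proj₂ {isMatching m} h))))
  (λ h → T-∧-intro (T-∧-proj₁ h)
    (all-sublists (notLarger m) (E X) (dominating⇒maximal m (E X) (T-∧-proj₂ {isMatching m} h))))

meetsAny : List ℕ → Edge → Bool
meetsAny D e = any (λ d → incident d e) D

avoids : List ℕ → List Edge → Bool
avoids D m = all (λ d → not (covers m d)) D

-- Maximal matchings of L − D subject to A and B, read on sublists of L: the vertices of D stay
-- uncovered and the edges at D need not be dominated.
maxMatching : List Edge → List ℕ → List Item → List Item → List Edge → Bool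
maxMatching L D A B m =
  isMatching m ∧ (all (λ e → touches m e ∨ meetsAny D e) L ∧ (avoids D m ∧ (all (satA m) A ∧ all (satB m) B)))

#maxMatchings : List Edge → List ℕ → List Item → List Item → ℕ
#maxMatchings L D A B = count (maxMatching L D A B) (sublists L)

Ψ⁻-#maxMatchings : ∀ A X B → Ψ⁻ A X B ≡ #maxMatchings (E X) [] A B
Ψ⁻-#maxMatchings A X B = count-sublists-cong _ _ (E X) λ m s →
  begin
    isMaximalMatching X m ∧ all (satA m) A ∧ all (satB m) B
  ≡⟨ cong (_∧ _) (isMaximalMatching-dominating X m s) ⟩
    (isMatching m ∧ all (touches m) (E X)) ∧ all (satA m) A ∧ all (satB m) B
  ≡⟨ cong (λ z → (isMatching m ∧ z) ∧ _) (all-cong _ _ (E X) (λ e _ → sym (∨-identityʳ (touches m e)))) ⟩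
    (isMatching m ∧ all (λ e → touches m e ∨ false) (E X)) ∧ all (satA m) A ∧ all (satB m) B
  ≡⟨ by-truth-table 4 ((# 0 ∧ᶠ # 1) ∧ᶠ # 2 ∧ᶠ # 3) (# 0 ∧ᶠ # 1 ∧ᶠ ⊤ᶠ ∧ᶠ # 2 ∧ᶠ # 3) tt
       (isMatching m ∷ all (λ e → touches m e ∨ false) (E X) ∷ all (satA m) A ∷ all (satB m) B ∷ []) ⟩
    maxMatching (E X) [] A B m
  ∎

withoutVertex : ℕ → List Edge → List Edge
withoutVertex u = filterᵇ (λ e → not (incident u e))

-- The sublists of L avoiding u are exactly the sublists of L − u.
count-avoiding : ∀ (p : List Edge → Bool) u L →
  count (λ m → p m ∧ not (covers m u)) (sublists L) ≡ count p (sublists (withoutVertex u L))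
count-avoiding p u [] with p []
... | true = refl
... | false = refl
count-avoiding p u (x ∷ L) with incident u x in eq
... | true = trans (count-sublists-∷ _ x L) (trans (cong₂ _+_ (count-avoiding p u L) none) (+-identityʳ _))
  where
  none : count (λ m → p (x ∷ m) ∧ not (incident u x ∨ covers m u)) (sublists L) ≡ 0
  none rewrite eq = count-false _ (sublists L) (λ m → ∧-zeroʳ (p (x ∷ m)))
... | false = trans (count-sublists-∷ _ x L)
                (trans (cong₂ _+_ (count-avoiding p u L) kept) (sym (count-sublists-∷ p x (withoutVertex u L))))
  where
  kept : count (λ m → p (x ∷ m) ∧ not (incident u x ∨ covers m u)) (sublists L)
       ≡ count (p ∘ (x ∷_)) (sublists (withoutVertex u L))
  kept rewrite eq = count-avoiding (p ∘ (x ∷_)) u L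

#maxMatchings-withoutVertex : ∀ u L D A B →
  #maxMatchings (withoutVertex u L) D A B ≡ #maxMatchings L (u ∷ D) A B
#maxMatchings-withoutVertex u L D A B =
  trans (sym (count-avoiding (maxMatching (withoutVertex u L) D A B) u L)) (count-cong _ _ (sublists L) pt)
  where
  pt : ∀ m → (maxMatching (withoutVertex u L) D A B m ∧ not (covers m u)) ≡ maxMatching L (u ∷ D) A B m
  pt m rewrite all-filterᵇ (λ e → touches m e ∨ meetsAny D e) (λ e → not (incident u e)) L
             | all-cong (λ e → not (not (incident u e)) ∨ (touches m e ∨ meetsAny D e))
                        (λ e → touches m e ∨ (incident u e ∨ meetsAny D e)) L
                 (λ e _ → by-truth-table 3 (¬ᶠ ¬ᶠ # 0 ∨ᶠ (# 1 ∨ᶠ # 2)) (# 1 ∨ᶠ (# 0 ∨ᶠ # 2)) tt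
                            (incident u e ∷ touches m e ∷ meetsAny D e ∷ []))
    = by-truth-table 6 ((# 0 ∧ᶠ # 1 ∧ᶠ # 2 ∧ᶠ # 3 ∧ᶠ # 4) ∧ᶠ ¬ᶠ # 5)
                       (# 0 ∧ᶠ # 1 ∧ᶠ (¬ᶠ # 5 ∧ᶠ # 2) ∧ᶠ # 3 ∧ᶠ # 4) tt
        (isMatching m ∷ all (λ e → touches m e ∨ (incident u e ∨ meetsAny D e)) L ∷ avoids D m
          ∷ all (satA m) A ∷ all (satB m) B ∷ covers m u ∷ [])

all-pointwise-↭ᴱ : ∀ {X : Set} (f : X → List Edge → Bool) xs → (∀ x → Respects↭ᴱ (f x)) →
  Respects↭ᴱ (λ m → all (λ x → f x m) xs)
all-pointwise-↭ᴱ f [] h r = refl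
all-pointwise-↭ᴱ f (x ∷ xs) h r = cong₂ _∧_ (h x r) (all-pointwise-↭ᴱ f xs h r)

maxMatching-↭ᴱ : ∀ L D A B → Respects↭ᴱ (maxMatching L D A B)
maxMatching-↭ᴱ L D A B r =
  cong₂ _∧_ (isMatching-↭ᴱ r)
   (cong₂ _∧_ (all-pointwise-↭ᴱ (λ e m → touches m e ∨ meetsAny D e) L
               (λ e r′ → cong (_∨ meetsAny D e) (touches-↭ᴱ e r′)) r)
    (cong₂ _∧_ (all-pointwise-↭ᴱ (λ d m → not (covers m d)) D
                (λ d r′ → cong not (covers-↭ᴱ d r′)) r)
     (cong₂ _∧_ (all-pointwise-↭ᴱ (λ it m → satA m it) A satA-↭ᴱ r)
                (all-pointwise-↭ᴱ (λ it m → satB m it) B satB-↭ᴱ r))))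
  where
  satA-↭ᴱ : ∀ it → Respects↭ᴱ (λ m → satA m it)
  satA-↭ᴱ (vtx u) r = cong not (covers-↭ᴱ u r)
  satA-↭ᴱ (edg a b) r = cong not (memE-↭ᴱ (a , b) r)
  satB-↭ᴱ : ∀ it → Respects↭ᴱ (λ m → satB m it)
  satB-↭ᴱ (vtx u) r = covers-↭ᴱ u r
  satB-↭ᴱ (edg a b) r = memE-↭ᴱ (a , b) r

maxMatching-↭ᴱ-edges : ∀ {L L′} D A B m → L ↭ᴱ L′ → maxMatching L D A B m ≡ maxMatching L′ D A B m
maxMatching-↭ᴱ-edges D A B m r =
  cong (isMatching m ∧_) (cong (_∧ _) (all-↭ᴱ (λ e → touches m e ∨ meetsAny D e)
    (λ a b → cong₂ _∨_ (touches-flip m a b) (any-cong _ _ D (λ d → incident-flip d a b))) r))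

#maxMatchings-↭ᴱ : ∀ {L L′} D A B → L ↭ᴱ L′ → #maxMatchings L D A B ≡ #maxMatchings L′ D A B
#maxMatchings-↭ᴱ {L} {L′} D A B r =
  trans (count-sublists-↭ᴱ (maxMatching L D A B) (maxMatching-↭ᴱ L D A B) r)
        (count-cong _ _ (sublists L′) (λ m → maxMatching-↭ᴱ-edges D A B m r))

-- Component l of Ψ_xy counts maximal matchings of X, X − x, X − y or X − x − y that
-- are required to cover x and/or y; a mode records which.
record Mode : Set where
  constructor mode
  field
    delˣ delʸ reqˣ reqʸ : Bool
open Mode

modeOf : Fin 9 → Mode
modeOf = lookup
  ( mode false false false false ∷ mode true false false false ∷ mode false true false false
  ∷ mode true true false false ∷ mode false false true true ∷ mode true false false true
  ∷ mode false true true false ∷ mode false false true false ∷ mode false false false true ∷ [])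

deleted : ℕ → ℕ → Bool → Bool → List ℕ
deleted x y a b = (if a then x ∷ [] else []) ++ (if b then y ∷ [] else [])

required : ℕ → ℕ → Mode → List Item
required x y M = (if reqˣ M then vtx x ∷ [] else []) ++ (if reqʸ M then vtx y ∷ [] else [])

component : List Edge → ℕ → ℕ → List Item → List Item → Fin 9 → ℕ
component L x y A B l = #maxMatchings L (deleted x y (delˣ M) (delʸ M)) A (required x y M ++ B)
  where M = modeOf l

Ψvec-component : ∀ Vs L x y A B l → Ψvec A (graph Vs L) x y B l ≡ component L x y A B l
Ψvec-component Vs L x y A B zero = Ψ⁻-#maxMatchings A (graph Vs L) B
Ψvec-component Vs L x y A B (suc zero) =
  trans (Ψ⁻-#maxMatchings A (delV (graph Vs L) x) B) (#maxMatchings-withoutVertex x L [] A B)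
Ψvec-component Vs L x y A B (suc (suc zero)) =
  trans (Ψ⁻-#maxMatchings A (delV (graph Vs L) y) B) (#maxMatchings-withoutVertex y L [] A B)
Ψvec-component Vs L x y A B (suc (suc (suc zero))) =
  trans (Ψ⁻-#maxMatchings A (delV (delV (graph Vs L) x) y) B)
        (trans (#maxMatchings-withoutVertex y (withoutVertex x L) [] A B) (#maxMatchings-withoutVertex x L (y ∷ []) A B))
Ψvec-component Vs L x y A B (suc (suc (suc (suc zero)))) = Ψ⁻-#maxMatchings A (graph Vs L) (vtx x ∷ vtx y ∷ B)
Ψvec-component Vs L x y A B (suc (suc (suc (suc (suc zero))))) =
  trans (Ψ⁻-#maxMatchings A (delV (graph Vs L) x) (vtx y ∷ B)) (#maxMatchings-withoutVertex x L [] A (vtx y ∷ B))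
Ψvec-component Vs L x y A B (suc (suc (suc (suc (suc (suc zero)))))) =
  trans (Ψ⁻-#maxMatchings A (delV (graph Vs L) y) (vtx x ∷ B)) (#maxMatchings-withoutVertex y L [] A (vtx x ∷ B))
Ψvec-component Vs L x y A B (suc (suc (suc (suc (suc (suc (suc zero))))))) = Ψ⁻-#maxMatchings A (graph Vs L) (vtx x ∷ B)
Ψvec-component Vs L x y A B (suc (suc (suc (suc (suc (suc (suc (suc zero)))))))) = Ψ⁻-#maxMatchings A (graph Vs L) (vtx y ∷ B)

-- Functions of (a , b , x , y): a, b say whether u, w are deleted; x, y whether they are covered.
Table : Set
Table = Bool → Bool → Bool → Bool → ℕ

_·_ : Table → Table → ℕ
c · N = ∑ᵇ λ a → ∑ᵇ λ b → ∑ᵇ λ x → ∑ᵇ λ y → c a b x y * N a b x y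

profile : List Edge → ℕ → ℕ → List Item → List Item → Table
profile L u w A B a b x y =
  count (λ m → maxMatching L (deleted u w a b) A B m ∧ ((covers m u == x) ∧ (covers m w == y))) (sublists L)

meetsRequirements : Mode → Bool → Bool → Bool
meetsRequirements M x y = (not (reqˣ M) ∨ x) ∧ (not (reqʸ M) ∨ y)

allowed : Mode → Bool → Bool → Bool
allowed M x y = meetsRequirements M x y ∧ (not (delˣ M ∧ x) ∧ not (delʸ M ∧ y))

indicator : Bool → ℕ
indicator c = if c then 1 else 0

selector : Fin 9 → Table
selector l a b x y = indicator (((a == delˣ M) ∧ (b == delʸ M)) ∧ allowed M x y)
  where M = modeOf l

all-satB-required : ∀ m u w M → all (satB m) (required u w M) ≡ meetsRequirements M (covers m u) (covers m w)
all-satB-required m u w (mode _ _ true true) = cong (covers m u ∧_) (∧-identityʳ (covers m w))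
all-satB-required m u w (mode _ _ true false) = refl
all-satB-required m u w (mode _ _ false true) = ∧-identityʳ (covers m w)
all-satB-required m u w (mode _ _ false false) = refl

==-subst : ∀ c x (h : Bool → Bool) → ((c == x) ∧ h c) ≡ ((c == x) ∧ h x)
==-subst true true h = refl
==-subst true false h = refl
==-subst false true h = refl
==-subst false false h = refl

==-sym : ∀ a b → (a == b) ≡ (b == a)
==-sym true true = refl
==-sym true false = refl
==-sym false true = refl
==-sym false false = refl

-- Once the cover states of u and w are fixed to x and y, a condition on them becomes a constant.
fix-cover-states : ∀ (g : Bool → Bool → Bool) P cu cw x y →
  (((g cu cw ∧ P) ∧ (cu == x)) ∧ (cw == y)) ≡ (g x y ∧ (P ∧ ((cu == x) ∧ (cw == y))))
fix-cover-states g P cu cw x y =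
  begin
    ((g cu cw ∧ P) ∧ (cu == x)) ∧ (cw == y)
  ≡⟨ by-truth-table 4 (((# 0 ∧ᶠ # 1) ∧ᶠ # 2) ∧ᶠ # 3) (# 2 ∧ᶠ # 3 ∧ᶠ # 0 ∧ᶠ # 1) tt
       (g cu cw ∷ P ∷ (cu == x) ∷ (cw == y) ∷ []) ⟩
    (cu == x) ∧ (cw == y) ∧ g cu cw ∧ P
  ≡⟨ ==-subst cu x (λ c → (cw == y) ∧ g c cw ∧ P) ⟩
    (cu == x) ∧ (cw == y) ∧ g x cw ∧ P
  ≡⟨ cong ((cu == x) ∧_) (==-subst cw y (λ c → g x c ∧ P)) ⟩
    (cu == x) ∧ (cw == y) ∧ g x y ∧ P
  ≡⟨ by-truth-table 4 (# 2 ∧ᶠ # 3 ∧ᶠ # 0 ∧ᶠ # 1) (# 0 ∧ᶠ (# 1 ∧ᶠ (# 2 ∧ᶠ # 3))) tt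
       (g x y ∷ P ∷ (cu == x) ∷ (cw == y) ∷ []) ⟩
    g x y ∧ (P ∧ ((cu == x) ∧ (cw == y)))
  ∎

component-by-cover-states : ∀ L u w A B l → let M = modeOf l in
  component L u w A B l ≡
  ∑ᵇ λ x → ∑ᵇ λ y → if meetsRequirements M x y then profile L u w A B (delˣ M) (delʸ M) x y else 0
component-by-cover-states L u w A B l =
  trans (count-split P (λ m → covers m u) (sublists L))
   (∑ᵇ-cong λ x → trans (count-split (λ m → P m ∧ (covers m u == x)) (λ m → covers m w) (sublists L))
     (∑ᵇ-cong λ y → trans (count-cong _ _ (sublists L) (λ m → pt m x y))
       (count-guard (meetsRequirements M x y) _ (sublists L))))
  where
  M = modeOf l
  D = deleted u w (delˣ M) (delʸ M)
  P = maxMatching L D A (required u w M ++ B)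
  pt : ∀ m x y → ((P m ∧ (covers m u == x)) ∧ (covers m w == y)) ≡
                 (meetsRequirements M x y ∧ (maxMatching L D A B m ∧ ((covers m u == x) ∧ (covers m w == y))))
  pt m x y rewrite all-++ (satB m) (required u w M) B | all-satB-required m u w M =
    trans (cong (λ z → (z ∧ (covers m u == x)) ∧ (covers m w == y))
            (by-truth-table 6 (# 0 ∧ᶠ # 1 ∧ᶠ # 2 ∧ᶠ # 3 ∧ᶠ (# 4 ∧ᶠ # 5)) (# 4 ∧ᶠ (# 0 ∧ᶠ # 1 ∧ᶠ # 2 ∧ᶠ # 3 ∧ᶠ # 5)) tt
              (isMatching m ∷ all (λ e → touches m e ∨ meetsAny D e) L ∷ avoids D m ∷ all (satA m) A
                ∷ meetsRequirements M (covers m u) (covers m w) ∷ all (satB m) B ∷ [])))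
     (fix-cover-states (meetsRequirements M) (maxMatching L D A B m) (covers m u) (covers m w) x y)

==-true : ∀ {c x} → T (c == x) → c ≡ x
==-true {true} {true} _ = refl
==-true {false} {false} _ = refl

maxMatching⇒avoids : ∀ L D A B m → T (maxMatching L D A B m) → T (avoids D m)
maxMatching⇒avoids L D A B m h =
  T-∧-proj₁ (T-∧-proj₂ {all (λ e → touches m e ∨ meetsAny D e) L} (T-∧-proj₂ {isMatching m} h))

profile-deleted-covered₁ : ∀ L u w A B b y → profile L u w A B true b true y ≡ 0
profile-deleted-covered₁ L u w A B b y = count-false _ (sublists L) λ m → ¬T⇒≡false λ h →
  T-not-elim (uncovered m b (T-∧-proj₁ h))
    (subst T (sym (==-true {covers m u} (T-∧-proj₁ (T-∧-proj₂ {maxMatching L (deleted u w true b) A B m} h)))) tt)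
  where
  uncovered : ∀ m b → T (maxMatching L (deleted u w true b) A B m) → T (not (covers m u))
  uncovered m b h = T-∧-proj₁ (maxMatching⇒avoids L (deleted u w true b) A B m h)

profile-deleted-covered₂ : ∀ L u w A B a x → profile L u w A B a true x true ≡ 0
profile-deleted-covered₂ L u w A B a x = count-false _ (sublists L) λ m → ¬T⇒≡false λ h →
  T-not-elim (uncovered m a (T-∧-proj₁ h))
    (subst T (sym (==-true {covers m w} (T-∧-proj₂ {covers m u == x}
       (T-∧-proj₂ {maxMatching L (deleted u w a true) A B m} h)))) tt)
  where
  uncovered : ∀ m a → T (maxMatching L (deleted u w a true) A B m) → T (not (covers m w))
  uncovered m true h = T-∧-proj₁ (T-∧-proj₂ {not (covers m u)} (maxMatching⇒avoids L (deleted u w true true) A B m h))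
  uncovered m false h = T-∧-proj₁ (maxMatching⇒avoids L (deleted u w false true) A B m h)

guard-vanishing : ∀ (d₁ x d₂ y c : Bool) (n : ℕ) → (T (d₁ ∧ x) → n ≡ 0) → (T (d₂ ∧ y) → n ≡ 0) →
  (if c then n else 0) ≡ (if c ∧ (not (d₁ ∧ x) ∧ not (d₂ ∧ y)) then n else 0)
guard-vanishing d₁ x d₂ y false n _ _ = refl
guard-vanishing true true d₂ y true n h _ = h tt
guard-vanishing true false true true true n _ h = h tt
guard-vanishing false x true true true n _ h = h tt
guard-vanishing true false true false true n _ _ = refl
guard-vanishing true false false y true n _ _ = refl
guard-vanishing false x true false true n _ _ = refl
guard-vanishing false x false y true n _ _ = refl

indicator-* : ∀ c n → indicator c * n ≡ (if c then n else 0)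
indicator-* true n = +-identityʳ n
indicator-* false n = refl

·-slice : ∀ a₀ b₀ (f : Bool → Bool → Bool) N →
  (λ a b x y → indicator (((a == a₀) ∧ (b == b₀)) ∧ f x y)) · N ≡
  ∑ᵇ (λ x → ∑ᵇ (λ y → if f x y then N a₀ b₀ x y else 0))
·-slice true true f N =
  trans (+-identityʳ _) (trans (+-identityʳ _) (∑ᵇ-cong λ x → ∑ᵇ-cong λ y → indicator-* (f x y) (N true true x y)))
·-slice true false f N = trans (+-identityʳ _) (∑ᵇ-cong λ x → ∑ᵇ-cong λ y → indicator-* (f x y) (N true false x y))
·-slice false true f N = trans (+-identityʳ _) (∑ᵇ-cong λ x → ∑ᵇ-cong λ y → indicator-* (f x y) (N false true x y))
·-slice false false f N = ∑ᵇ-cong λ x → ∑ᵇ-cong λ y → indicator-* (f x y) (N false false x y)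

component-selector : ∀ L u w A B l → component L u w A B l ≡ selector l · profile L u w A B
component-selector L u w A B l =
  trans (component-by-cover-states L u w A B l)
   (trans (∑ᵇ-cong λ x → ∑ᵇ-cong λ y →
             guard-vanishing (delˣ M) x (delʸ M) y (meetsRequirements M x y) _ (vanish₁ x y) (vanish₂ x y))
     (sym (·-slice (delˣ M) (delʸ M) (allowed M) (profile L u w A B))))
  where
  M = modeOf l
  vanish₁ : ∀ x y → T (delˣ M ∧ x) → profile L u w A B (delˣ M) (delʸ M) x y ≡ 0
  vanish₁ x y h with delˣ M | x
  ... | true | true = profile-deleted-covered₁ L u w A B (delʸ M) y
  vanish₂ : ∀ x y → T (delʸ M ∧ y) → profile L u w A B (delˣ M) (delʸ M) x y ≡ 0
  vanish₂ x y h with delʸ M | y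
  ... | true | true = profile-deleted-covered₂ L u w A B (delˣ M) x

-- Gluing two edge lists along two vertices

MeetOnlyAt : List Edge → List Edge → ℕ → ℕ → Set
MeetOnlyAt E₁ E₂ u w = ∀ p → T (covers E₁ p) → T (covers E₂ p) → (p ≡ u) ⊎ (p ≡ w)

MeetOnlyAt-sym : ∀ {E₁ E₂ u w} → MeetOnlyAt E₁ E₂ u w → MeetOnlyAt E₂ E₁ u w
MeetOnlyAt-sym h p a b = h p b a

-- For an edge item an uncovered first endpoint suffices: then no sublist of L contains the edge.
Outside : List Edge → Item → Set
Outside L (vtx a) = covers L a ≡ false
Outside L (edg a b) = covers L a ≡ false

covers-⊆ : ∀ {m L} z → m ⊆ L → T (covers m z) → T (covers L z)
covers-⊆ z s h with T-any (incident z) _ h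
... | g , g∈ , ig = any-T (incident z) (⊆-lookup s g∈) ig

uncovered-⊆ : ∀ {m L} z → m ⊆ L → covers L z ≡ false → covers m z ≡ false
uncovered-⊆ z s h = ¬T⇒≡false (λ t → T-not-elim (subst T (cong not (sym h)) tt) (covers-⊆ z s t))

covers-++ : ∀ m₁ m₂ p → covers (m₁ ++ m₂) p ≡ (covers m₁ p ∨ covers m₂ p)
covers-++ m₁ m₂ p = any-++ (incident p) m₁ m₂

memE-++ : ∀ e m₁ m₂ → memE e (m₁ ++ m₂) ≡ (memE e m₁ ∨ memE e m₂)
memE-++ e m₁ m₂ = any-++ (sameEdge e) m₁ m₂

coveredAmong : ℕ → ℕ → Bool → Bool → ℕ → Bool
coveredAmong u w x y p = ((p ≡ᵇ u) ∧ x) ∨ ((p ≡ᵇ w) ∧ y)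

covers-at-interface : ∀ {m₂ E₁ E₂ u w} → m₂ ⊆ E₂ → MeetOnlyAt E₁ E₂ u w → ∀ p → T (covers E₁ p) →
  covers m₂ p ≡ coveredAmong u w (covers m₂ u) (covers m₂ w) p
covers-at-interface {m₂} {E₁} {E₂} {u} {w} s meet p h₁ with p ≡ᵇ u in e₁ | p ≡ᵇ w in e₂
... | true | true rewrite T-≡ᵇ {p} {u} (≡true⇒T e₁) | T-≡ᵇ {u} {w} (≡true⇒T e₂) =
  sym (∨-idem (covers m₂ w))
... | true | false rewrite T-≡ᵇ {p} {u} (≡true⇒T e₁) = sym (∨-identityʳ (covers m₂ u))
... | false | true rewrite T-≡ᵇ {p} {w} (≡true⇒T e₂) = refl
... | false | false = ¬T⇒≡false λ t → shared (meet p h₁ (covers-⊆ p s t))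
  where
  shared : (p ≡ u) ⊎ (p ≡ w) → ⊥
  shared (inj₁ refl) = subst T e₁ (≡ᵇ-refl p)
  shared (inj₂ refl) = subst T e₂ (≡ᵇ-refl p)

isMatching-++ : ∀ m₁ m₂ →
  isMatching (m₁ ++ m₂) ≡ (isMatching m₁ ∧ (isMatching m₂ ∧ all (λ e → all (disjointE e) m₂) m₁))
isMatching-++ [] m₂ = sym (∧-identityʳ (isMatching m₂))
isMatching-++ (e ∷ m₁) m₂ rewrite all-++ (disjointE e) m₁ m₂ | isMatching-++ m₁ m₂ =
  by-truth-table 5 ((# 0 ∧ᶠ # 1) ∧ᶠ (# 2 ∧ᶠ (# 3 ∧ᶠ # 4))) ((# 0 ∧ᶠ # 2) ∧ᶠ (# 3 ∧ᶠ (# 1 ∧ᶠ # 4))) tt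
    (all (disjointE e) m₁ ∷ all (disjointE e) m₂ ∷ isMatching m₁ ∷ isMatching m₂
      ∷ all (λ e → all (disjointE e) m₂) m₁ ∷ [])

missesAmong : ℕ → ℕ → Bool → Bool → Edge → Bool
missesAmong u w x y (p , q) = not (coveredAmong u w x y p ∨ coveredAmong u w x y q)

all-missesAmong : ∀ (m₁ : List Edge) u w x y →
  all (missesAmong u w x y) m₁ ≡ (not (covers m₁ u ∧ x) ∧ not (covers m₁ w ∧ y))
all-missesAmong [] u w x y = refl
all-missesAmong ((p , q) ∷ m₁) u w x y
  rewrite all-missesAmong m₁ u w x y | ≡ᵇ-sym u p | ≡ᵇ-sym u q | ≡ᵇ-sym w p | ≡ᵇ-sym w q =
  by-truth-table 8
    (¬ᶠ (((# 0 ∧ᶠ # 4) ∨ᶠ (# 2 ∧ᶠ # 5)) ∨ᶠ ((# 1 ∧ᶠ # 4) ∨ᶠ (# 3 ∧ᶠ # 5))) ∧ᶠ (¬ᶠ (# 6 ∧ᶠ # 4) ∧ᶠ ¬ᶠ (# 7 ∧ᶠ # 5)))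
    (¬ᶠ (((# 0 ∨ᶠ # 1) ∨ᶠ # 6) ∧ᶠ # 4) ∧ᶠ ¬ᶠ (((# 2 ∨ᶠ # 3) ∨ᶠ # 7) ∧ᶠ # 5)) tt
    ((p ≡ᵇ u) ∷ (q ≡ᵇ u) ∷ (p ≡ᵇ w) ∷ (q ≡ᵇ w) ∷ x ∷ y ∷ covers m₁ u ∷ covers m₁ w ∷ [])

disjoint-across : ∀ {m₁ m₂ E₁ E₂ u w} → m₁ ⊆ E₁ → m₂ ⊆ E₂ → MeetOnlyAt E₁ E₂ u w →
  all (λ e → all (disjointE e) m₂) m₁ ≡ (not (covers m₁ u ∧ covers m₂ u) ∧ not (covers m₁ w ∧ covers m₂ w))
disjoint-across {m₁} {m₂} {E₁} {E₂} {u} {w} s₁ s₂ meet =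
  trans (all-cong _ _ m₁ pt) (all-missesAmong m₁ u w (covers m₂ u) (covers m₂ w))
  where
  pt : ∀ e → e ∈ m₁ → all (disjointE e) m₂ ≡ missesAmong u w (covers m₂ u) (covers m₂ w) e
  pt (p , q) e∈ rewrite all-disjointE p q m₂
    | covers-at-interface {m₂} {E₁} {E₂} s₂ meet p (any-T (incident p) (⊆-lookup s₁ e∈) (incident-fst p q))
    | covers-at-interface {m₂} {E₁} {E₂} s₂ meet q (any-T (incident q) (⊆-lookup s₁ e∈) (incident-snd p q)) = refl

-- m₁ touches e, counting u and w as covered when x and y hold.
touchesWith : List Edge → ℕ → ℕ → Bool → Bool → Edge → Bool
touchesWith m₁ u w x y (p , q) = (covers m₁ p ∨ coveredAmong u w x y p) ∨ (covers m₁ q ∨ coveredAmong u w x y q)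

touches-++ˡ : ∀ {m₁ m₂ E₁ E₂ u w} D → m₂ ⊆ E₂ → MeetOnlyAt E₁ E₂ u w → ∀ e → e ∈ E₁ →
  (touches (m₁ ++ m₂) e ∨ meetsAny D e) ≡ (touchesWith m₁ u w (covers m₂ u) (covers m₂ w) e ∨ meetsAny D e)
touches-++ˡ {m₁} {m₂} {E₁} {E₂} D s₂ meet (p , q) e∈
  rewrite covers-++ m₁ m₂ p | covers-++ m₁ m₂ q
    | covers-at-interface {m₂} {E₁} {E₂} s₂ meet p (any-T (incident p) e∈ (incident-fst p q))
    | covers-at-interface {m₂} {E₁} {E₂} s₂ meet q (any-T (incident q) e∈ (incident-snd p q)) = refl

meetsAny-outside : ∀ D {E₂ e} → (∀ d → d ∈ D → covers E₂ d ≡ false) → e ∈ E₂ → meetsAny D e ≡ false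
meetsAny-outside [] h e∈ = refl
meetsAny-outside (d ∷ D) {E₂} {e} h e∈ rewrite meetsAny-outside D {E₂} {e} (λ d′ d∈ → h d′ (there d∈)) e∈ =
  trans (∨-identityʳ (incident d e))
    (¬T⇒≡false (λ t → T-not-elim (subst T (cong not (sym (h d (here refl)))) tt) (any-T (incident d) e∈ t)))

-- Seen from E₂, the vertices among u, w covered by m₁ behave as deleted.
touches-across-bool : ∀ a b p q u w cp cq →
  (((coveredAmong u w a b p ∨ cp) ∨ (coveredAmong u w a b q ∨ cq)) ∨ false)
    ≡ ((cp ∨ cq) ∨ meetsAny (deleted u w a b) (p , q))
touches-across-bool true true p q u w cp cq rewrite ≡ᵇ-sym u p | ≡ᵇ-sym u q | ≡ᵇ-sym w p | ≡ᵇ-sym w q =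
  by-truth-table 6 (((((# 0 ∧ᶠ ⊤ᶠ) ∨ᶠ (# 2 ∧ᶠ ⊤ᶠ)) ∨ᶠ # 4) ∨ᶠ (((# 1 ∧ᶠ ⊤ᶠ) ∨ᶠ (# 3 ∧ᶠ ⊤ᶠ)) ∨ᶠ # 5)) ∨ᶠ ⊥ᶠ)
                   ((# 4 ∨ᶠ # 5) ∨ᶠ ((# 0 ∨ᶠ # 1) ∨ᶠ ((# 2 ∨ᶠ # 3) ∨ᶠ ⊥ᶠ))) tt
    ((p ≡ᵇ u) ∷ (q ≡ᵇ u) ∷ (p ≡ᵇ w) ∷ (q ≡ᵇ w) ∷ cp ∷ cq ∷ [])
touches-across-bool true false p q u w cp cq rewrite ≡ᵇ-sym u p | ≡ᵇ-sym u q =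
  by-truth-table 6 (((((# 0 ∧ᶠ ⊤ᶠ) ∨ᶠ (# 2 ∧ᶠ ⊥ᶠ)) ∨ᶠ # 4) ∨ᶠ (((# 1 ∧ᶠ ⊤ᶠ) ∨ᶠ (# 3 ∧ᶠ ⊥ᶠ)) ∨ᶠ # 5)) ∨ᶠ ⊥ᶠ)
                   ((# 4 ∨ᶠ # 5) ∨ᶠ ((# 0 ∨ᶠ # 1) ∨ᶠ ⊥ᶠ)) tt
    ((p ≡ᵇ u) ∷ (q ≡ᵇ u) ∷ (p ≡ᵇ w) ∷ (q ≡ᵇ w) ∷ cp ∷ cq ∷ [])
touches-across-bool false true p q u w cp cq rewrite ≡ᵇ-sym w p | ≡ᵇ-sym w q =
  by-truth-table 6 (((((# 0 ∧ᶠ ⊥ᶠ) ∨ᶠ (# 2 ∧ᶠ ⊤ᶠ)) ∨ᶠ # 4) ∨ᶠ (((# 1 ∧ᶠ ⊥ᶠ) ∨ᶠ (# 3 ∧ᶠ ⊤ᶠ)) ∨ᶠ # 5)) ∨ᶠ ⊥ᶠ)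
                   ((# 4 ∨ᶠ # 5) ∨ᶠ ((# 2 ∨ᶠ # 3) ∨ᶠ ⊥ᶠ)) tt
    ((p ≡ᵇ u) ∷ (q ≡ᵇ u) ∷ (p ≡ᵇ w) ∷ (q ≡ᵇ w) ∷ cp ∷ cq ∷ [])
touches-across-bool false false p q u w cp cq =
  by-truth-table 6 (((((# 0 ∧ᶠ ⊥ᶠ) ∨ᶠ (# 2 ∧ᶠ ⊥ᶠ)) ∨ᶠ # 4) ∨ᶠ (((# 1 ∧ᶠ ⊥ᶠ) ∨ᶠ (# 3 ∧ᶠ ⊥ᶠ)) ∨ᶠ # 5)) ∨ᶠ ⊥ᶠ)
                   ((# 4 ∨ᶠ # 5) ∨ᶠ ⊥ᶠ) tt
    ((p ≡ᵇ u) ∷ (q ≡ᵇ u) ∷ (p ≡ᵇ w) ∷ (q ≡ᵇ w) ∷ cp ∷ cq ∷ [])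

touches-++ʳ : ∀ {m₁ m₂ E₁ E₂ u w} D → m₁ ⊆ E₁ → MeetOnlyAt E₁ E₂ u w →
  (∀ d → d ∈ D → covers E₂ d ≡ false) → ∀ e → e ∈ E₂ →
  (touches (m₁ ++ m₂) e ∨ meetsAny D e) ≡ (touches m₂ e ∨ meetsAny (deleted u w (covers m₁ u) (covers m₁ w)) e)
touches-++ʳ {m₁} {m₂} {E₁} {E₂} {u} {w} D s₁ meet D-out (p , q) e∈
  rewrite covers-++ m₁ m₂ p | covers-++ m₁ m₂ q
    | covers-at-interface {m₁} {E₂} {E₁} s₁ (MeetOnlyAt-sym {E₁} {E₂} meet) p (any-T (incident p) e∈ (incident-fst p q))
    | covers-at-interface {m₁} {E₂} {E₁} s₁ (MeetOnlyAt-sym {E₁} {E₂} meet) q (any-T (incident q) e∈ (incident-snd p q))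
    | meetsAny-outside D {E₂} {p , q} D-out e∈
  = touches-across-bool (covers m₁ u) (covers m₁ w) p q u w (covers m₂ p) (covers m₂ q)

avoids-++ : ∀ {m₁ m₂ E₂} D → m₂ ⊆ E₂ → (∀ d → d ∈ D → covers E₂ d ≡ false) →
  avoids D (m₁ ++ m₂) ≡ avoids D m₁
avoids-++ {m₁} {m₂} D s₂ D-out = all-cong _ _ D λ d d∈ →
  cong not (trans (covers-++ m₁ m₂ d) (trans (cong (covers m₁ d ∨_) (uncovered-⊆ d s₂ (D-out d d∈)))
                                             (∨-identityʳ (covers m₁ d))))

memE-outside : ∀ {m L} a b → m ⊆ L → covers L a ≡ false → memE (a , b) m ≡ false
memE-outside {m} a b s h =
  ¬T⇒≡false (λ t → T-not-elim (subst T (cong not (sym h)) tt) (covers-⊆ a s (memE⇒covers {m} a b t)))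

satA-++ˡ : ∀ {m₁ m₂ E₂} it → m₂ ⊆ E₂ → Outside E₂ it → satA (m₁ ++ m₂) it ≡ satA m₁ it
satA-++ˡ {m₁} {m₂} (vtx a) s₂ h rewrite covers-++ m₁ m₂ a | uncovered-⊆ a s₂ h = cong not (∨-identityʳ _)
satA-++ˡ {m₁} {m₂} (edg a b) s₂ h rewrite memE-++ (a , b) m₁ m₂ | memE-outside a b s₂ h = cong not (∨-identityʳ _)

satB-++ˡ : ∀ {m₁ m₂ E₂} it → m₂ ⊆ E₂ → Outside E₂ it → satB (m₁ ++ m₂) it ≡ satB m₁ it
satB-++ˡ {m₁} {m₂} (vtx a) s₂ h rewrite covers-++ m₁ m₂ a | uncovered-⊆ a s₂ h = ∨-identityʳ _
satB-++ˡ {m₁} {m₂} (edg a b) s₂ h rewrite memE-++ (a , b) m₁ m₂ | memE-outside a b s₂ h = ∨-identityʳ _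

satA-++ʳ : ∀ {m₁ m₂ E₁} it → m₁ ⊆ E₁ → Outside E₁ it → satA (m₁ ++ m₂) it ≡ satA m₂ it
satA-++ʳ {m₁} {m₂} (vtx a) s₁ h rewrite covers-++ m₁ m₂ a | uncovered-⊆ a s₁ h = refl
satA-++ʳ {m₁} {m₂} (edg a b) s₁ h rewrite memE-++ (a , b) m₁ m₂ | memE-outside a b s₁ h = refl

satB-++ʳ : ∀ {m₁ m₂ E₁} it → m₁ ⊆ E₁ → Outside E₁ it → satB (m₁ ++ m₂) it ≡ satB m₂ it
satB-++ʳ {m₁} {m₂} (vtx a) s₁ h rewrite covers-++ m₁ m₂ a | uncovered-⊆ a s₁ h = refl
satB-++ʳ {m₁} {m₂} (edg a b) s₁ h rewrite memE-++ (a , b) m₁ m₂ | memE-outside a b s₁ h = refl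

avoids-deleted : ∀ u w a b m₂ → avoids (deleted u w a b) m₂ ≡ (not (a ∧ covers m₂ u) ∧ not (b ∧ covers m₂ w))
avoids-deleted u w true true m₂ = cong (not (covers m₂ u) ∧_) (∧-identityʳ (not (covers m₂ w)))
avoids-deleted u w true false m₂ = refl
avoids-deleted u w false true m₂ = ∧-identityʳ (not (covers m₂ w))
avoids-deleted u w false false m₂ = refl

-- Conditions on the part m₁ ⊆ E₁ of a maximal matching whose part in E₂ covers u iff x and w iff y.
maxMatchingᴸ : List Edge → ℕ → ℕ → List ℕ → List Item → List Item → List Edge → Bool → Bool → Bool
maxMatchingᴸ E₁ u w D A B m₁ x y =
  isMatching m₁ ∧ (all (λ e → touchesWith m₁ u w x y e ∨ meetsAny D e) E₁
                   ∧ (avoids D m₁ ∧ (all (satA m₁) A ∧ all (satB m₁) B)))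

compatibleᴸ : List Edge → ℕ → ℕ → List ℕ → List Item → List Item → List Edge → Bool → Bool → Bool
compatibleᴸ E₁ u w D A B m₁ x y = maxMatchingᴸ E₁ u w D A B m₁ x y ∧ (not (covers m₁ u ∧ x) ∧ not (covers m₁ w ∧ y))

record Gluable (E₁ E₂ : List Edge) (u w : ℕ) (D : List ℕ) (A₁ A₂ B₁ B₂ : List Item) : Set where
  field
    meet : MeetOnlyAt E₁ E₂ u w
    D-outside : ∀ d → d ∈ D → covers E₂ d ≡ false
    A₁-outside : ∀ it → it ∈ A₁ → Outside E₂ it
    B₁-outside : ∀ it → it ∈ B₁ → Outside E₂ it
    A₂-outside : ∀ it → it ∈ A₂ → Outside E₁ it
    B₂-outside : ∀ it → it ∈ B₂ → Outside E₁ it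

glueTerm : List Edge → ℕ → ℕ → List ℕ → List Item → List Item → Table → List Edge → ℕ
glueTerm E₁ u w D A B N m₁ =
  ∑ᵇ λ x → ∑ᵇ λ y → if compatibleᴸ E₁ u w D A B m₁ x y then N (covers m₁ u) (covers m₁ w) x y else 0

module _ {E₁ E₂ : List Edge} {u w : ℕ} {D : List ℕ} {A₁ A₂ B₁ B₂ : List Item}
         (G : Gluable E₁ E₂ u w D A₁ A₂ B₁ B₂) where
  open Gluable G

  maxMatching-++ : ∀ m₁ m₂ → m₁ ⊆ E₁ → m₂ ⊆ E₂ →
    maxMatching (E₁ ++ E₂) D (A₁ ++ A₂) (B₁ ++ B₂) (m₁ ++ m₂) ≡
    ((maxMatchingᴸ E₁ u w D A₁ B₁ m₁ (covers m₂ u) (covers m₂ w)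
        ∧ (not (covers m₁ u ∧ covers m₂ u) ∧ not (covers m₁ w ∧ covers m₂ w)))
      ∧ maxMatching E₂ (deleted u w (covers m₁ u) (covers m₁ w)) A₂ B₂ m₂)
  maxMatching-++ m₁ m₂ s₁ s₂ =
    trans (cong₂ _∧_ matching (cong₂ _∧_ dominated (cong₂ _∧_ avoiding (cong₂ _∧_ forbidden requirements))))
     (trans (by-truth-table 11
        ((# 0 ∧ᶠ (# 1 ∧ᶠ (# 2 ∧ᶠ # 3))) ∧ᶠ ((# 4 ∧ᶠ # 5) ∧ᶠ (# 6 ∧ᶠ ((# 7 ∧ᶠ # 8) ∧ᶠ (# 9 ∧ᶠ # 10)))))
        (((# 0 ∧ᶠ (# 4 ∧ᶠ (# 6 ∧ᶠ (# 7 ∧ᶠ # 9)))) ∧ᶠ (# 2 ∧ᶠ # 3)) ∧ᶠ (# 1 ∧ᶠ (# 5 ∧ᶠ ((# 2 ∧ᶠ # 3) ∧ᶠ (# 8 ∧ᶠ # 10)))))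
        tt (I₁ ∷ I₂ ∷ nu ∷ nw ∷ C₁ ∷ C₂ ∷ N₁ ∷ a₁ ∷ a₂ ∷ b₁ ∷ b₂ ∷ []))
      (cong (λ z → ((I₁ ∧ (C₁ ∧ (N₁ ∧ (a₁ ∧ b₁)))) ∧ (nu ∧ nw)) ∧ (I₂ ∧ (C₂ ∧ (z ∧ (a₂ ∧ b₂)))))
            (sym (avoids-deleted u w (covers m₁ u) (covers m₁ w) m₂))))
    where
    I₁ = isMatching m₁
    I₂ = isMatching m₂
    nu = not (covers m₁ u ∧ covers m₂ u)
    nw = not (covers m₁ w ∧ covers m₂ w)
    C₁ = all (λ e → touchesWith m₁ u w (covers m₂ u) (covers m₂ w) e ∨ meetsAny D e) E₁
    C₂ = all (λ e → touches m₂ e ∨ meetsAny (deleted u w (covers m₁ u) (covers m₁ w)) e) E₂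
    N₁ = avoids D m₁
    a₁ = all (satA m₁) A₁
    a₂ = all (satA m₂) A₂
    b₁ = all (satB m₁) B₁
    b₂ = all (satB m₂) B₂
    matching : isMatching (m₁ ++ m₂) ≡ (I₁ ∧ (I₂ ∧ (nu ∧ nw)))
    matching = trans (isMatching-++ m₁ m₂)
                     (cong (λ z → I₁ ∧ (I₂ ∧ z)) (disjoint-across {m₁} {m₂} {E₁} {E₂} s₁ s₂ meet))
    dominated : all (λ e → touches (m₁ ++ m₂) e ∨ meetsAny D e) (E₁ ++ E₂) ≡ (C₁ ∧ C₂)
    dominated = trans (all-++ _ E₁ E₂)
      (cong₂ _∧_ (all-cong _ _ E₁ (touches-++ˡ {m₁} {m₂} {E₁} {E₂} D s₂ meet))
                 (all-cong _ _ E₂ (touches-++ʳ {m₁} {m₂} {E₁} {E₂} D s₁ meet D-outside)))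
    avoiding : avoids D (m₁ ++ m₂) ≡ N₁
    avoiding = avoids-++ {m₁} {m₂} D s₂ D-outside
    forbidden : all (satA (m₁ ++ m₂)) (A₁ ++ A₂) ≡ (a₁ ∧ a₂)
    forbidden = trans (all-++ _ A₁ A₂)
      (cong₂ _∧_ (all-cong _ _ A₁ (λ it it∈ → satA-++ˡ {m₁} {m₂} it s₂ (A₁-outside it it∈)))
                 (all-cong _ _ A₂ (λ it it∈ → satA-++ʳ {m₁} {m₂} it s₁ (A₂-outside it it∈))))
    requirements : all (satB (m₁ ++ m₂)) (B₁ ++ B₂) ≡ (b₁ ∧ b₂)
    requirements = trans (all-++ _ B₁ B₂)
      (cong₂ _∧_ (all-cong _ _ B₁ (λ it it∈ → satB-++ˡ {m₁} {m₂} it s₂ (B₁-outside it it∈)))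
                 (all-cong _ _ B₂ (λ it it∈ → satB-++ʳ {m₁} {m₂} it s₁ (B₂-outside it it∈))))

  #maxMatchings-glue : #maxMatchings (E₁ ++ E₂) D (A₁ ++ A₂) (B₁ ++ B₂) ≡
    sum (map (glueTerm E₁ u w D A₁ B₁ (profile E₂ u w A₂ B₂)) (sublists E₁))
  #maxMatchings-glue = trans (count-sublists-++ _ E₁ E₂) (sum-sublists-cong _ _ E₁ inner)
    where
    inner : ∀ m₁ → m₁ ⊆ E₁ →
      count (λ m₂ → maxMatching (E₁ ++ E₂) D (A₁ ++ A₂) (B₁ ++ B₂) (m₁ ++ m₂)) (sublists E₂)
        ≡ glueTerm E₁ u w D A₁ B₁ (profile E₂ u w A₂ B₂) m₁
    inner m₁ s₁ =
      trans (count-split _ (λ m₂ → covers m₂ u) (sublists E₂))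
       (∑ᵇ-cong λ x → trans (count-split _ (λ m₂ → covers m₂ w) (sublists E₂))
         (∑ᵇ-cong λ y → trans (count-sublists-cong _ _ E₂ (λ m₂ s₂ → pt m₂ s₂ x y))
           (count-guard (compatibleᴸ E₁ u w D A₁ B₁ m₁ x y) _ (sublists E₂))))
      where
      pt : ∀ m₂ → m₂ ⊆ E₂ → ∀ x y →
        ((maxMatching (E₁ ++ E₂) D (A₁ ++ A₂) (B₁ ++ B₂) (m₁ ++ m₂) ∧ (covers m₂ u == x)) ∧ (covers m₂ w == y)) ≡
        (compatibleᴸ E₁ u w D A₁ B₁ m₁ x y ∧
          (maxMatching E₂ (deleted u w (covers m₁ u) (covers m₁ w)) A₂ B₂ m₂ ∧ ((covers m₂ u == x) ∧ (covers m₂ w == y))))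
      pt m₂ s₂ x y =
        trans (cong (λ z → (z ∧ (covers m₂ u == x)) ∧ (covers m₂ w == y)) (maxMatching-++ m₁ m₂ s₁ s₂))
          (fix-cover-states (compatibleᴸ E₁ u w D A₁ B₁ m₁)
             (maxMatching E₂ (deleted u w (covers m₁ u) (covers m₁ w)) A₂ B₂ m₂) (covers m₂ u) (covers m₂ w) x y)

-- Relabelling by a translation

shift : ℕ → Edge → Edge
shift s (a , b) = (s + a , s + b)

shiftItem : ℕ → Item → Item
shiftItem s (vtx a) = vtx (s + a)
shiftItem s (edg a b) = edg (s + a) (s + b)

≡ᵇ-shift : ∀ s a b → (s + a ≡ᵇ s + b) ≡ (a ≡ᵇ b)
≡ᵇ-shift zero a b = refl
≡ᵇ-shift (suc s) a b = ≡ᵇ-shift s a b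

incident-shift : ∀ s p e → incident (s + p) (shift s e) ≡ incident p e
incident-shift s p (a , b) rewrite ≡ᵇ-shift s p a | ≡ᵇ-shift s p b = refl

covers-shift : ∀ s m p → covers (map (shift s) m) (s + p) ≡ covers m p
covers-shift s m p = trans (any-map (incident (s + p)) (shift s) m) (any-cong _ _ m (incident-shift s p))

sameEdge-shift : ∀ s e g → sameEdge (shift s e) (shift s g) ≡ sameEdge e g
sameEdge-shift s (a , b) (c , d) rewrite ≡ᵇ-shift s a c | ≡ᵇ-shift s b d | ≡ᵇ-shift s a d | ≡ᵇ-shift s b c = refl

memE-shift : ∀ s e m → memE (shift s e) (map (shift s) m) ≡ memE e m
memE-shift s e m = trans (any-map (sameEdge (shift s e)) (shift s) m) (any-cong _ _ m (sameEdge-shift s e))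

disjointE-shift : ∀ s e g → disjointE (shift s e) (shift s g) ≡ disjointE e g
disjointE-shift s (a , b) g rewrite incident-shift s a g | incident-shift s b g = refl

all-shift : ∀ {A B : Set} (f : B → Bool) (g : A → Bool) (h : A → B) xs → (∀ x → f (h x) ≡ g x) →
  all f (map h xs) ≡ all g xs
all-shift f g h xs eq = trans (all-map f h xs) (all-cong _ _ xs (λ x _ → eq x))

isMatching-shift : ∀ s m → isMatching (map (shift s) m) ≡ isMatching m
isMatching-shift s [] = refl
isMatching-shift s (e ∷ m) =
  cong₂ _∧_ (all-shift (disjointE (shift s e)) (disjointE e) (shift s) m (disjointE-shift s e)) (isMatching-shift s m)

meetsAny-shift : ∀ s D e → meetsAny (map (s +_) D) (shift s e) ≡ meetsAny D e
meetsAny-shift s D e = trans (any-map _ (s +_) D) (any-cong _ _ D (λ d → incident-shift s d e))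

avoids-shift : ∀ s D m → avoids (map (s +_) D) (map (shift s) m) ≡ avoids D m
avoids-shift s D m = all-shift _ _ (s +_) D (λ d → cong not (covers-shift s m d))

satA-shift : ∀ s m it → satA (map (shift s) m) (shiftItem s it) ≡ satA m it
satA-shift s m (vtx a) = cong not (covers-shift s m a)
satA-shift s m (edg a b) = cong not (memE-shift s (a , b) m)

satB-shift : ∀ s m it → satB (map (shift s) m) (shiftItem s it) ≡ satB m it
satB-shift s m (vtx a) = covers-shift s m a
satB-shift s m (edg a b) = memE-shift s (a , b) m

coveredAmong-shift : ∀ s u w x y p → coveredAmong (s + u) (s + w) x y (s + p) ≡ coveredAmong u w x y p
coveredAmong-shift s u w x y p rewrite ≡ᵇ-shift s p u | ≡ᵇ-shift s p w = refl

touchesWith-shift : ∀ s m u w x y e →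
  touchesWith (map (shift s) m) (s + u) (s + w) x y (shift s e) ≡ touchesWith m u w x y e
touchesWith-shift s m u w x y (a , b)
  rewrite covers-shift s m a | covers-shift s m b | coveredAmong-shift s u w x y a | coveredAmong-shift s u w x y b = refl

compatibleᴸ-shift : ∀ s E₁ u w D A B m x y →
  compatibleᴸ (map (shift s) E₁) (s + u) (s + w) (map (s +_) D) (map (shiftItem s) A) (map (shiftItem s) B)
              (map (shift s) m) x y
    ≡ compatibleᴸ E₁ u w D A B m x y
compatibleᴸ-shift s E₁ u w D A B m x y
  rewrite isMatching-shift s m
    | all-shift (λ e → touchesWith (map (shift s) m) (s + u) (s + w) x y e ∨ meetsAny (map (s +_) D) e)
                (λ e → touchesWith m u w x y e ∨ meetsAny D e) (shift s) E₁
                (λ e → cong₂ _∨_ (touchesWith-shift s m u w x y e) (meetsAny-shift s D e))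
    | avoids-shift s D m
    | all-shift (satA (map (shift s) m)) (satA m) (shiftItem s) A (satA-shift s m)
    | all-shift (satB (map (shift s) m)) (satB m) (shiftItem s) B (satB-shift s m)
    | covers-shift s m u | covers-shift s m w = refl

sublists-map : ∀ {A B : Set} (f : A → B) L → sublists (map f L) ≡ map (map f) (sublists L)
sublists-map f [] = refl
sublists-map f (x ∷ L) rewrite sublists-map f L =
  trans (cong (map (map f) (sublists L) ++_) (trans (sym (map-∘ (sublists L))) (map-∘ (sublists L))))
        (sym (map-++ (map f) (sublists L) (map (x ∷_) (sublists L))))

glueSum-shift : ∀ s E₁ u w D A B N →
  sum (map (glueTerm (map (shift s) E₁) (s + u) (s + w) (map (s +_) D) (map (shiftItem s) A) (map (shiftItem s) B) N)
           (sublists (map (shift s) E₁)))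
    ≡ sum (map (glueTerm E₁ u w D A B N) (sublists E₁))
glueSum-shift s E₁ u w D A B N rewrite sublists-map (shift s) E₁ =
  trans (sum-map-map _ (map (shift s)) (sublists E₁)) (sum-map-cong _ _ (sublists E₁) pt)
  where
  pt : ∀ m → glueTerm (map (shift s) E₁) (s + u) (s + w) (map (s +_) D) (map (shiftItem s) A) (map (shiftItem s) B) N
                      (map (shift s) m)
           ≡ glueTerm E₁ u w D A B N m
  pt m = ∑ᵇ-cong λ x → ∑ᵇ-cong λ y →
    cong₂ (λ c n → if c then n else 0) (compatibleᴸ-shift s E₁ u w D A B m x y)
          (cong₂ (λ a b → N a b x y) (covers-shift s m u) (covers-shift s m w))

∑ᵇ-+ : ∀ (F G : Bool → ℕ) → ∑ᵇ (λ b → F b + G b) ≡ ∑ᵇ F + ∑ᵇ G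
∑ᵇ-+ F G = +-interchange (F true) (G true) (F false) (G false)
  where
  +-interchange : ∀ a b c d → (a + b) + (c + d) ≡ (a + c) + (b + d)
  +-interchange = solve-∀

∑ᵇ-*ˡ : ∀ k (F : Bool → ℕ) → k * ∑ᵇ F ≡ ∑ᵇ (λ b → k * F b)
∑ᵇ-*ˡ k F = *-distribˡ-+ k (F true) (F false)

·-+ˡ : ∀ (f g N : Table) → (λ a b x y → f a b x y + g a b x y) · N ≡ f · N + g · N
·-+ˡ f g N =
  trans (∑ᵇ-cong λ a →
   trans (∑ᵇ-cong λ b →
    trans (∑ᵇ-cong λ x →
     trans (∑ᵇ-cong λ y → *-distribʳ-+ (N a b x y) (f a b x y) (g a b x y))
           (∑ᵇ-+ (λ y → f a b x y * N a b x y) (λ y → g a b x y * N a b x y)))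
          (∑ᵇ-+ (λ x → ∑ᵇ λ y → f a b x y * N a b x y) (λ x → ∑ᵇ λ y → g a b x y * N a b x y)))
         (∑ᵇ-+ (λ b → ∑ᵇ λ x → ∑ᵇ λ y → f a b x y * N a b x y) (λ b → ∑ᵇ λ x → ∑ᵇ λ y → g a b x y * N a b x y)))
        (∑ᵇ-+ (λ a → (λ b x y → f a b x y) ·₃ N a) (λ a → (λ b x y → g a b x y) ·₃ N a))
  where
  _·₃_ : (Bool → Bool → Bool → ℕ) → (Bool → Bool → Bool → ℕ) → ℕ
  c ·₃ M = ∑ᵇ λ b → ∑ᵇ λ x → ∑ᵇ λ y → c b x y * M b x y

*-·ˡ : ∀ k (c N : Table) → k * (c · N) ≡ (λ a b x y → k * c a b x y) · N
*-·ˡ k c N =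
  trans (∑ᵇ-*ˡ k (λ a → ∑ᵇ λ b → ∑ᵇ λ x → ∑ᵇ λ y → c a b x y * N a b x y)) (∑ᵇ-cong λ a →
   trans (∑ᵇ-*ˡ k (λ b → ∑ᵇ λ x → ∑ᵇ λ y → c a b x y * N a b x y)) (∑ᵇ-cong λ b →
    trans (∑ᵇ-*ˡ k (λ x → ∑ᵇ λ y → c a b x y * N a b x y)) (∑ᵇ-cong λ x →
     trans (∑ᵇ-*ˡ k (λ y → c a b x y * N a b x y)) (∑ᵇ-cong λ y → sym (*-assoc k (c a b x y) (N a b x y))))))

sum-·ˡ : ∀ {A : Set} (ls : List A) (k : A → ℕ) (c : A → Table) N →
  sum (map (λ l → k l * (c l · N)) ls) ≡ (λ a b x y → sum (map (λ l → k l * c l a b x y) ls)) · N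
sum-·ˡ [] k c N = refl
sum-·ˡ (l ∷ ls) k c N =
  trans (cong₂ _+_ (*-·ˡ (k l) (c l) N) (sum-·ˡ ls k c N))
        (sym (·-+ˡ (λ a b x y → k l * c l a b x y) (λ a b x y → sum (map (λ l → k l * c l a b x y) ls)) N))

·-congˡ : ∀ (c c′ N : Table) → (∀ a b x y → c a b x y ≡ c′ a b x y) → c · N ≡ c′ · N
·-congˡ c c′ N h = ∑ᵇ-cong λ a → ∑ᵇ-cong λ b → ∑ᵇ-cong λ x → ∑ᵇ-cong λ y → cong (_* N a b x y) (h a b x y)

everyᵇ : (Bool → Bool) → Bool
everyᵇ g = g true ∧ g false

everyᵇ-sound : ∀ (g : Bool → Bool) z → T (everyᵇ g) → T (g z)
everyᵇ-sound g true h = T-∧-proj₁ h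
everyᵇ-sound g false h = T-∧-proj₂ {g true} h

tableEq : Table → Table → Bool
tableEq c c′ = everyᵇ λ a → everyᵇ λ b → everyᵇ λ x → everyᵇ λ y → c a b x y ≡ᵇ c′ a b x y

tableEq-sound : ∀ c c′ → T (tableEq c c′) → ∀ a b x y → c a b x y ≡ c′ a b x y
tableEq-sound c c′ h a b x y =
  ≡ᵇ⇒≡ _ _ (everyᵇ-sound (λ y → c a b x y ≡ᵇ c′ a b x y) y
    (everyᵇ-sound (λ x → everyᵇ λ y → c a b x y ≡ᵇ c′ a b x y) x
      (everyᵇ-sound (λ b → everyᵇ λ x → everyᵇ λ y → c a b x y ≡ᵇ c′ a b x y) b
        (everyᵇ-sound (λ a → everyᵇ λ b → everyᵇ λ x → everyᵇ λ y → c a b x y ≡ᵇ c′ a b x y) a h))))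

glueTable : List (List Edge) → List Edge → ℕ → ℕ → List ℕ → List Item → List Item → Table
glueTable ms E₁ u w D A B a b x y =
  sum (map (λ m₁ → indicator (((covers m₁ u == a) ∧ (covers m₁ w == b)) ∧ compatibleᴸ E₁ u w D A B m₁ x y)) ms)

glueSum-· : ∀ ms E₁ u w D A B N → sum (map (glueTerm E₁ u w D A B N) ms) ≡ glueTable ms E₁ u w D A B · N
glueSum-· [] E₁ u w D A B N = refl
glueSum-· (m ∷ ms) E₁ u w D A B N =
  trans (cong₂ _+_ single (glueSum-· ms E₁ u w D A B N))
        (sym (·-+ˡ (λ a b x y → indicator (((covers m u == a) ∧ (covers m w == b)) ∧ C x y))
                   (glueTable ms E₁ u w D A B) N))
  where
  C = compatibleᴸ E₁ u w D A B m
  single : glueTerm E₁ u w D A B N m ≡ (λ a b x y → indicator (((covers m u == a) ∧ (covers m w == b)) ∧ C x y)) · N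
  single = trans (sym (·-slice (covers m u) (covers m w) C N))
    (·-congˡ _ _ N λ a b x y → cong (λ z → indicator (z ∧ C x y))
       (cong₂ _∧_ (==-sym a (covers m u)) (==-sym b (covers m w))))

glueTerm-vanishes : ∀ E₁ u w D A B N m → (isMatching m ∧ all (satA m) A) ≡ false → glueTerm E₁ u w D A B N m ≡ 0
glueTerm-vanishes E₁ u w D A B N m h = ∑ᵇ-cong {g = λ _ → 0} λ x → ∑ᵇ-cong {g = λ _ → 0} λ y → vanish x y
  where
  vanish : ∀ x y → (if compatibleᴸ E₁ u w D A B m x y then N (covers m u) (covers m w) x y else 0) ≡ 0
  vanish x y with compatibleᴸ E₁ u w D A B m x y in eq
  ... | false = refl
  ... | true = ⊥-elim (subst T h (T-∧-intro {isMatching m} (T-∧-proj₁ G) (T-∧-proj₁ {all (satA m) A} rest)))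
    where
    G : T (maxMatchingᴸ E₁ u w D A B m x y)
    G = T-∧-proj₁ {maxMatchingᴸ E₁ u w D A B m x y} (≡true⇒T eq)
    rest : T (all (satA m) A ∧ all (satB m) B)
    rest = T-∧-proj₂ {avoids D m}
      (T-∧-proj₂ {all (λ e → touchesWith m u w x y e ∨ meetsAny D e) E₁} (T-∧-proj₂ {isMatching m} G))

sum-filterᵇ : ∀ {A : Set} (f : A → ℕ) (p : A → Bool) xs → (∀ x → p x ≡ false → f x ≡ 0) →
  sum (map f xs) ≡ sum (map f (filterᵇ p xs))
sum-filterᵇ f p [] h = refl
sum-filterᵇ f p (x ∷ xs) h with p x in eq
... | true = cong (f x +_) (sum-filterᵇ f p xs h)
... | false rewrite h x eq = sum-filterᵇ f p xs h

memV-applyUpTo : ∀ N (f : ℕ → ℕ) i → i < N → T (memV (f i) (applyUpTo f N))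
memV-applyUpTo (suc N) f zero lt = T-∨-inj₁ (≡ᵇ-refl (f zero))
memV-applyUpTo (suc N) f (suc i) (s≤s lt) = T-∨-inj₂ {f (suc i) ≡ᵇ f zero} (memV-applyUpTo N (f ∘ suc) i lt)

memV-upTo : ∀ z N → z < N → T (memV z (upTo N))
memV-upTo z N = memV-applyUpTo N id z

covers-++⁻ : ∀ L₁ L₂ p → T (covers (L₁ ++ L₂) p) → T (covers L₁ p) ⊎ T (covers L₂ p)
covers-++⁻ L₁ L₂ p h rewrite covers-++ L₁ L₂ p = T-∨-elim h

covers-filterᵇ : ∀ (q : Edge → Bool) L p → T (covers (filterᵇ q L) p) → T (covers L p)
covers-filterᵇ q [] p h = h
covers-filterᵇ q (e ∷ L) p h with q e
... | false = T-∨-inj₂ {incident p e} (covers-filterᵇ q L p h)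
... | true with T-∨-elim {incident p e} h
... | inj₁ i = T-∨-inj₁ i
... | inj₂ r = T-∨-inj₂ {incident p e} (covers-filterᵇ q L p r)

covers-map-shift : ∀ s L p → T (covers (map (shift s) L) p) → Σ ℕ (λ a → (p ≡ s + a) × T (covers L a))
covers-map-shift s ((x , y) ∷ L) p h with T-∨-elim {incident p (shift s (x , y))} h
... | inj₂ r with covers-map-shift s L p r
...   | a , eq , c = a , eq , T-∨-inj₂ {incident a (x , y)} c
covers-map-shift s ((x , y) ∷ L) p h | inj₁ i with T-∨-elim {p ≡ᵇ s + x} i
... | inj₁ q = x , T-≡ᵇ {p} q , T-∨-inj₁ (incident-fst x y)
... | inj₂ q = y , T-≡ᵇ {p} q , T-∨-inj₁ (incident-snd x y)

endpointsAtMost : ℕ → List Edge → Bool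
endpointsAtMost B = all (λ e → (proj₁ e ≤ᵇ B) ∧ (proj₂ e ≤ᵇ B))

covers-≤ : ∀ B L a → T (endpointsAtMost B L) → T (covers L a) → a ≤ B
covers-≤ B L a hB hc with T-any (incident a) L hc
... | (x , y) , e∈ , i with T-all (λ e → (proj₁ e ≤ᵇ B) ∧ (proj₂ e ≤ᵇ B)) hB e∈ | T-∨-elim {a ≡ᵇ x} i
...   | hxy | inj₁ q rewrite T-≡ᵇ {a} {x} q = ≤ᵇ⇒≤ x B (T-∧-proj₁ hxy)
...   | hxy | inj₂ q rewrite T-≡ᵇ {a} {y} q = ≤ᵇ⇒≤ y B (T-∧-proj₂ {x ≤ᵇ B} hxy)

covers-map-shift-≤ : ∀ s B L p → T (endpointsAtMost B L) → T (covers (map (shift s) L) p) →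
  Σ ℕ (λ a → (p ≡ s + a) × (a ≤ B))
covers-map-shift-≤ s B L p hB h with covers-map-shift s L p h
... | a , eq , c = a , eq , covers-≤ B L a hB c

filterᵇ-cong : ∀ {A : Set} (p q : A → Bool) L → (∀ x → x ∈ L → p x ≡ q x) → filterᵇ p L ≡ filterᵇ q L
filterᵇ-cong p q [] h = refl
filterᵇ-cong p q (x ∷ L) h with p x | q x | h x (here refl)
... | true | true | refl = cong (x ∷_) (filterᵇ-cong p q L (λ y y∈ → h y (there y∈)))
... | false | false | refl = filterᵇ-cong p q L (λ y y∈ → h y (there y∈))

filterᵇ-all : ∀ {A : Set} (q : A → Bool) L → (∀ x → x ∈ L → T (q x)) → filterᵇ q L ≡ L
filterᵇ-all q [] h = refl
filterᵇ-all q (x ∷ L) h with q x | h x (here refl)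
... | true | _ = cong (x ∷_) (filterᵇ-all q L (λ y y∈ → h y (there y∈)))

sameEdge-trans : ∀ e g g′ → T (sameEdge e g) → T (sameEdge e g′) → T (sameEdge g g′)
sameEdge-trans (a , b) (c , d) g′ h₁ h₂ with sameEdge-cases {a} {b} {c} {d} h₁
... | inj₁ (refl , refl) = h₂
... | inj₂ (refl , refl) = subst T (sameEdge-flipˡ a b g′) h₂

↭ᴱ-extract : ∀ e L → T (noDupE L) → T (memE e L) → L ↭ᴱ (e ∷ filterᵇ (λ g → not (sameEdge e g)) L)
↭ᴱ-extract e (g ∷ L) nd e∈ with sameEdge e g in eq
... | true rewrite filterᵇ-all (λ g′ → not (sameEdge e g′)) L
      (λ g′ g′∈ → T-not-intro (λ t → T-not-elim (T-∧-proj₁ nd)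
                     (any-T (sameEdge g) g′∈ (sameEdge-trans e g g′ (≡true⇒T eq) t))))
    = to-front e g (≡true⇒T eq)
  where
  to-front : ∀ e g → T (sameEdge e g) → (g ∷ L) ↭ᴱ (e ∷ L)
  to-front (a , b) (c , d) s with sameEdge-cases {a} {b} {c} {d} s
  ... | inj₁ (refl , refl) = ↭ᴱ-refl
  ... | inj₂ (refl , refl) = flip b a L
... | false = ↭ᴱ-trans (prep g (↭ᴱ-extract e L (T-∧-proj₂ {not (memE g L)} nd) e∈)) (swap g e _)

-- The hexagonal chain

-- The chain of hexagons j, j+1, …, starting with the rung shared with hexagon j − 1.
chainFrom : ℕ → List K3 → List Edge
chainFrom j ks = (4 * j , 4 * j + 1) ∷ chainEdges j ks

hexEdges-shift : ∀ j k → hexEdges j k ≡ map (shift (4 * j)) (hexEdges 0 k)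
hexEdges-shift j k1 rewrite +-identityʳ (4 * j) = refl
hexEdges-shift j k2 rewrite +-identityʳ (4 * j) = refl
hexEdges-shift j k3 rewrite +-identityʳ (4 * j) = refl

4*suc : ∀ j c → 4 * suc j + c ≡ 4 * j + (4 + c)
4*suc = solve-∀

hexEdges-suc : ∀ j k → hexEdges (suc j) k ≡ map (shift (4 * j)) (hexEdges 1 k)
hexEdges-suc j k = trans (hexEdges-shift (suc j) k) (trans (shift-suc (hexEdges 0 k)) (cong (map (shift (4 * j))) (one k)))
  where
  shift-suc : ∀ L → map (shift (4 * suc j)) L ≡ map (shift (4 * j)) (map (shift 4) L)
  shift-suc [] = refl
  shift-suc ((a , b) ∷ L) = cong₂ _∷_ (cong₂ _,_ (4*suc j a) (4*suc j b)) (shift-suc L)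
  one : ∀ k → map (shift 4) (hexEdges 0 k) ≡ hexEdges 1 k
  one k1 = refl
  one k2 = refl
  one k3 = refl

covers-hexEdges : ∀ j k p → T (covers (hexEdges j k) p) → Σ ℕ (λ a → (p ≡ 4 * j + a) × (a ≤ 5))
covers-hexEdges j k p h =
  covers-map-shift-≤ (4 * j) 5 (hexEdges 0 k) p (bounded k) (subst (λ L → T (covers L p)) (hexEdges-shift j k) h)
  where
  bounded : ∀ k → T (endpointsAtMost 5 (hexEdges 0 k))
  bounded k1 = tt
  bounded k2 = tt
  bounded k3 = tt

4*suc≡ : ∀ j → 4 * suc j ≡ 4 * j + 4
4*suc≡ = solve-∀

covers-chainEdges-≥ : ∀ j ks p → T (covers (chainEdges j ks) p) → 4 * j ≤ p
covers-chainEdges-≥ j (k ∷ ks) p h with covers-++⁻ (hexEdges j k) (chainEdges (suc j) ks) p h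
... | inj₁ hk with covers-hexEdges j k p hk
...   | a , refl , _ = m≤m+n (4 * j) a
covers-chainEdges-≥ j (k ∷ ks) p h | inj₂ hc =
  ≤-trans (m≤m+n (4 * j) 4) (subst (_≤ p) (4*suc≡ j) (covers-chainEdges-≥ (suc j) ks p hc))

shifted-< : ∀ s a c d → a < c → s + a < s + c + d
shifted-< s a c d a<c = ≤-trans (+-monoʳ-< s a<c) (m≤m+n (s + c) d)

covers-chainEdges-< : ∀ j ks p → T (covers (chainEdges j ks) p) → p < 4 * (j + length ks) + 2
covers-chainEdges-< j (k ∷ ks) p h with covers-++⁻ (hexEdges j k) (chainEdges (suc j) ks) p h
... | inj₁ hk with covers-hexEdges j k p hk
...   | a , refl , a≤5 = subst (4 * j + a <_) (sym (bound j (length ks))) (shifted-< (4 * j) a 6 (4 * length ks) (s≤s a≤5))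
  where
  bound : ∀ j l → 4 * (j + suc l) + 2 ≡ 4 * j + 6 + 4 * l
  bound = solve-∀
covers-chainEdges-< j (k ∷ ks) p h | inj₂ hc =
  subst (λ z → p < 4 * z + 2) (sym (+-suc j (length ks))) (covers-chainEdges-< (suc j) ks p hc)

covers-chainFrom-< : ∀ j ks p → T (covers (chainFrom j ks) p) → p < 4 * (j + length ks) + 2
covers-chainFrom-< j ks p h with T-∨-elim {incident p (4 * j , 4 * j + 1)} h
... | inj₂ hc = covers-chainEdges-< j ks p hc
... | inj₁ i = subst (p <_) (sym (bound j (length ks))) (rung-< (T-∨-elim {p ≡ᵇ 4 * j} i))
  where
  bound : ∀ j l → 4 * (j + l) + 2 ≡ 4 * j + 2 + 4 * l
  bound = solve-∀
  rung-< : T (p ≡ᵇ 4 * j) ⊎ T (p ≡ᵇ 4 * j + 1) → p < 4 * j + 2 + 4 * length ks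
  rung-< (inj₁ q) rewrite T-≡ᵇ {p} q =
    subst (_< 4 * j + 2 + 4 * length ks) (+-identityʳ (4 * j)) (shifted-< (4 * j) 0 2 (4 * length ks) (s≤s z≤n))
  rung-< (inj₂ q) rewrite T-≡ᵇ {p} q = shifted-< (4 * j) 1 2 (4 * length ks) (s≤s (s≤s z≤n))

rung-hexEdges : ∀ j k → T (memE (4 * j + 5 , 4 * j + 4) (hexEdges j k))
rung-hexEdges j k1 = ∈⇒memE {M = hexEdges j k1} (there (here refl))
rung-hexEdges j k2 = ∈⇒memE {M = hexEdges j k2} (there (there (here refl)))
rung-hexEdges j k3 = ∈⇒memE {M = hexEdges j k3} (there (there (there (here refl))))

memE-++⁺ʳ : ∀ e L₁ L₂ → T (memE e L₂) → T (memE e (L₁ ++ L₂))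
memE-++⁺ʳ e L₁ L₂ h rewrite memE-++ e L₁ L₂ = T-∨-inj₂ {memE e L₁} h

memE-++⁺ˡ : ∀ e L₁ L₂ → T (memE e L₁) → T (memE e (L₁ ++ L₂))
memE-++⁺ˡ e L₁ L₂ h rewrite memE-++ e L₁ L₂ = T-∨-inj₁ h

last-rung-chainEdges : ∀ P kA kB pre j → j + length pre ≡ P →
  T (memE (4 * P + 9 , 4 * P + 8) (chainEdges j (pre ++ kA ∷ kB ∷ [])))
last-rung-chainEdges P kA kB [] j refl rewrite +-identityʳ j =
  memE-++⁺ʳ (4 * j + 9 , 4 * j + 8) (hexEdges j kA) _ (memE-++⁺ˡ (4 * j + 9 , 4 * j + 8) (hexEdges (suc j) kB) []
    (subst (λ e → T (memE e (hexEdges (suc j) kB))) (cong₂ _,_ (4*suc j 5) (4*suc j 4)) (rung-hexEdges (suc j) kB)))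
last-rung-chainEdges P kA kB (k ∷ pre) j eq =
  memE-++⁺ʳ (4 * P + 9 , 4 * P + 8) (hexEdges j k) _ (last-rung-chainEdges P kA kB pre (suc j) (trans (sym (+-suc j (length pre))) eq))

-- K meets the chain of hexagons 0 … P + 1 only in d = 4P + 9 and c = 4P + 8.
record Attachment (K : Graph) (P : ℕ) : Set where
  field
    simple : T (simpleGraph K)
    dc∈K : T (memE (4 * P + 9 , 4 * P + 8) (E K))
    low-vertices : ∀ z → T (memV z (V K)) → z < 4 * P + 10 → (z ≡ 4 * P + 9) ⊎ (z ≡ 4 * P + 8)

module Attached {K : Graph} {P : ℕ} (H : Attachment K P) where
  open Attachment H public

  d c : ℕ
  d = 4 * P + 9
  c = 4 * P + 8

  endpoints-in-K : ∀ {a b} → (a , b) ∈ E K → T (not (a ≡ᵇ b)) × (T (memV a (V K)) × T (memV b (V K)))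
  endpoints-in-K {a} {b} e∈ with T-all _ (T-∧-proj₁ simple) e∈
  ... | h = T-∧-proj₁ h ,
            (T-∧-proj₁ (T-∧-proj₂ {not (a ≡ᵇ b)} h) , T-∧-proj₂ {memV a (V K)} (T-∧-proj₂ {not (a ≡ᵇ b)} h))

  covered-in-K : ∀ p → T (covers (E K) p) → T (memV p (V K))
  covered-in-K p h with T-any (incident p) (E K) h
  ... | (x , y) , e∈ , i with T-∨-elim {p ≡ᵇ x} i
  ...   | inj₁ q rewrite T-≡ᵇ {p} {x} q = proj₁ (proj₂ (endpoints-in-K e∈))
  ...   | inj₂ q rewrite T-≡ᵇ {p} {y} q = proj₂ (proj₂ (endpoints-in-K e∈))

  uncovered-in-K : ∀ p → p < 4 * P + 10 → (p ≡ d → ⊥) → (p ≡ c → ⊥) → covers (E K) p ≡ false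
  uncovered-in-K p p< p≢d p≢c = ¬T⇒≡false λ h → [ p≢d , p≢c ] (low-vertices p (covered-in-K p h) p<)

  Kʳ : List Edge
  Kʳ = filterᵇ (λ e → not (sameEdge (d , c) e)) (E K)

  E-K↭ᴱ : E K ↭ᴱ ((d , c) ∷ Kʳ)
  E-K↭ᴱ = ↭ᴱ-extract (d , c) (E K) (T-∧-proj₂ {all _ (E K)} simple) dc∈K

  module _ (kA kB : K3) (pre : List K3) (j : ℕ) (j+pre≡P : j + length pre ≡ P) where
    private
      L = chainFrom j (pre ++ kA ∷ kB ∷ [])

    covers-chain-< : ∀ p → T (covers L p) → p < 4 * P + 10
    covers-chain-< p h = subst (p <_) bound (covers-chainFrom-< j (pre ++ kA ∷ kB ∷ []) p h)
      where
      bound : 4 * (j + length (pre ++ kA ∷ kB ∷ [])) + 2 ≡ 4 * P + 10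
      bound = begin
          4 * (j + length (pre ++ kA ∷ kB ∷ [])) + 2
        ≡⟨ cong (λ z → 4 * (j + z) + 2) (length-++ pre) ⟩
          4 * (j + (length pre + 2)) + 2
        ≡⟨ arith j (length pre) ⟩
          4 * (j + length pre) + 10
        ≡⟨ cong (λ z → 4 * z + 10) j+pre≡P ⟩
          4 * P + 10
        ∎
        where
        arith : ∀ j l → 4 * (j + (l + 2)) + 2 ≡ 4 * (j + l) + 10
        arith = solve-∀

    memE-chain-K : ∀ e → e ∈ E K → memE e L ≡ sameEdge (d , c) e
    memE-chain-K (a , b) e∈ = T-ext to from
      where
      dc∈L : T (memE (d , c) L)
      dc∈L = T-∨-inj₂ {sameEdge (d , c) (4 * j , 4 * j + 1)} (last-rung-chainEdges P kA kB pre j j+pre≡P)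
      to : T (memE (a , b) L) → T (sameEdge (d , c) (a , b))
      to h with T-any (sameEdge (a , b)) L h | endpoints-in-K e∈
      ... | g , g∈ , s | a≢b , (a∈ , b∈)
          with low-vertices a a∈ (covers-chain-< a (any-T (incident a) g∈ (sameEdge-incident a s (incident-fst a b))))
             | low-vertices b b∈ (covers-chain-< b (any-T (incident b) g∈ (sameEdge-incident b s (incident-snd a b))))
      ...   | inj₁ refl | inj₁ refl = ⊥-elim (T-not-elim a≢b (≡ᵇ-refl a))
      ...   | inj₂ refl | inj₂ refl = ⊥-elim (T-not-elim a≢b (≡ᵇ-refl a))
      ...   | inj₁ refl | inj₂ refl = sameEdge-refl (d , c)
      ...   | inj₂ refl | inj₁ refl = T-∨-inj₂ {(d ≡ᵇ c) ∧ (c ≡ᵇ d)} (T-∧-intro (≡ᵇ-refl d) (≡ᵇ-refl c))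
      from : T (sameEdge (d , c) (a , b)) → T (memE (a , b) L)
      from s with sameEdge-cases {d} {c} {a} {b} s
      ... | inj₁ (refl , refl) = dc∈L
      ... | inj₂ (refl , refl) = subst T (memE-flip L d c) dc∈L

    K-without-chain : filterᵇ (λ e → not (memE e L)) (E K) ≡ Kʳ
    K-without-chain = filterᵇ-cong _ _ (E K) (λ e e∈ → cong not (memE-chain-K e e∈))

∈-deleted : ∀ {x y d} a b → d ∈ deleted x y a b → (d ≡ x) ⊎ (d ≡ y)
∈-deleted true b (here refl) = inj₁ refl
∈-deleted true true (there (here refl)) = inj₂ refl
∈-deleted false true (here refl) = inj₂ refl

∈-required : ∀ {x y it} M → it ∈ required x y M → (it ≡ vtx x) ⊎ (it ≡ vtx y)
∈-required (mode _ _ true _) (here refl) = inj₁ refl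
∈-required (mode _ _ true true) (there (here refl)) = inj₂ refl
∈-required (mode _ _ false true) (here refl) = inj₂ refl

deleted-shift : ∀ s a b → map (s +_) (deleted 1 0 a b) ≡ deleted (s + 1) s a b
deleted-shift s true true rewrite +-identityʳ s = refl
deleted-shift s true false = refl
deleted-shift s false true rewrite +-identityʳ s = refl
deleted-shift s false false = refl

required-shift : ∀ s M → map (shiftItem s) (required 1 0 M) ≡ required (s + 1) s M
required-shift s (mode _ _ true true) rewrite +-identityʳ s = refl
required-shift s (mode _ _ true false) = refl
required-shift s (mode _ _ false true) rewrite +-identityʳ s = refl
required-shift s (mode _ _ false false) = refl

component-glued : ∀ {L} s C E₂ u w A₁ B₁ A₂ B₂ l → let M = modeOf l in
  L ↭ᴱ map (shift s) C ++ E₂ →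
  Gluable (map (shift s) C) E₂ (s + u) (s + w) (deleted (s + 1) s (delˣ M) (delʸ M))
          (map (shiftItem s) A₁) A₂ (required (s + 1) s M ++ map (shiftItem s) B₁) B₂ →
  component L (s + 1) s (map (shiftItem s) A₁ ++ A₂) (map (shiftItem s) B₁ ++ B₂) l
    ≡ sum (map (glueTerm C u w (deleted 1 0 (delˣ M) (delʸ M)) A₁ (required 1 0 M ++ B₁) (profile E₂ (s + u) (s + w) A₂ B₂))
               (sublists C))
component-glued {L} s C E₂ u w A₁ B₁ A₂ B₂ l L↭ G =
  begin
    #maxMatchings L D (A₁′ ++ A₂) (required (s + 1) s M ++ (B₁′ ++ B₂))
  ≡⟨ cong (#maxMatchings L D (A₁′ ++ A₂)) (sym (++-assoc (required (s + 1) s M) B₁′ B₂)) ⟩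
    #maxMatchings L D (A₁′ ++ A₂) ((required (s + 1) s M ++ B₁′) ++ B₂)
  ≡⟨ #maxMatchings-↭ᴱ D (A₁′ ++ A₂) ((required (s + 1) s M ++ B₁′) ++ B₂) L↭ ⟩
    #maxMatchings (map (shift s) C ++ E₂) D (A₁′ ++ A₂) ((required (s + 1) s M ++ B₁′) ++ B₂)
  ≡⟨ #maxMatchings-glue G ⟩
    sum (map (glueTerm (map (shift s) C) (s + u) (s + w) D A₁′ (required (s + 1) s M ++ B₁′) N) (sublists (map (shift s) C)))
  ≡⟨ cong₂ (λ D′ B′ → sum (map (glueTerm (map (shift s) C) (s + u) (s + w) D′ A₁′ B′ N) (sublists (map (shift s) C))))
           (sym (deleted-shift s (delˣ M) (delʸ M)))
           (sym (trans (map-++ (shiftItem s) (required 1 0 M) B₁) (cong (_++ B₁′) (required-shift s M)))) ⟩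
    sum (map (glueTerm (map (shift s) C) (s + u) (s + w) (map (s +_) (deleted 1 0 (delˣ M) (delʸ M))) A₁′
                       (map (shiftItem s) (required 1 0 M ++ B₁)) N) (sublists (map (shift s) C)))
  ≡⟨ glueSum-shift s C u w (deleted 1 0 (delˣ M) (delʸ M)) A₁ (required 1 0 M ++ B₁) N ⟩
    sum (map (glueTerm C u w (deleted 1 0 (delˣ M) (delʸ M)) A₁ (required 1 0 M ++ B₁) N) (sublists C))
  ∎
  where
  M = modeOf l
  D = deleted (s + 1) s (delˣ M) (delʸ M)
  A₁′ = map (shiftItem s) A₁
  B₁′ = map (shiftItem s) B₁
  N = profile E₂ (s + u) (s + w) A₂ B₂

-- Finite checks on one and two hexagons

-- The edges of hexagon 0 other than the rung (5 , 4) it shares with hexagon 1.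
hexRest : K3 → List Edge
hexRest k1 = (1 , 5) ∷ (4 , 2) ∷ (2 , 3) ∷ (3 , 0) ∷ []
hexRest k2 = (1 , 2) ∷ (2 , 5) ∷ (4 , 3) ∷ (3 , 0) ∷ []
hexRest k3 = (1 , 2) ∷ (2 , 3) ∷ (3 , 5) ∷ (4 , 0) ∷ []

cell : K3 → List Edge
cell k = (0 , 1) ∷ hexRest k

-- Hexagons 0 and 1 with the left rung, without the right rung (9 , 8).
lastCells : K3 → K3 → List Edge
lastCells kA kB = (0 , 1) ∷ hexEdges 0 kA ++ map (shift 4) (hexRest kB)

hexEdges-0-↭ᴱ : ∀ s k R → map (shift s) (hexEdges 0 k) ++ R ↭ᴱ map (shift s) (hexRest k) ++ ((s + 4 , s + 5) ∷ R)
hexEdges-0-↭ᴱ s k1 R = prep _ (↭ᴱ-trans (↭ᴱ-shift _ (_ ∷ _ ∷ _ ∷ []) R) (↭ᴱ-++ˡ (_ ∷ _ ∷ _ ∷ []) (flip (s + 5) (s + 4) R)))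
hexEdges-0-↭ᴱ s k2 R = prep _ (prep _ (↭ᴱ-trans (↭ᴱ-shift _ (_ ∷ _ ∷ []) R) (↭ᴱ-++ˡ (_ ∷ _ ∷ []) (flip (s + 5) (s + 4) R))))
hexEdges-0-↭ᴱ s k3 R = prep _ (prep _ (prep _ (↭ᴱ-trans (↭ᴱ-shift _ (_ ∷ []) R) (↭ᴱ-++ˡ (_ ∷ []) (flip (s + 5) (s + 4) R)))))

hexEdges-1-↭ᴱ : ∀ s k R → map (shift s) (hexEdges 1 k) ++ R
    ↭ᴱ map (shift s) (map (shift 4) (hexRest k)) ++ ((s + 9 , s + 8) ∷ R)
hexEdges-1-↭ᴱ s k1 R = prep _ (↭ᴱ-shift _ (_ ∷ _ ∷ _ ∷ []) R)
hexEdges-1-↭ᴱ s k2 R = prep _ (prep _ (↭ᴱ-shift _ (_ ∷ _ ∷ []) R))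
hexEdges-1-↭ᴱ s k3 R = prep _ (prep _ (prep _ (↭ᴱ-shift _ (_ ∷ []) R)))

-- e = 4P + eOffset and f = 4P + fOffset, for the last hexagon P + 1.
eOffset fOffset : K3 → ℕ
eOffset k1 = 5
eOffset k2 = 6
eOffset k3 = 7
fOffset k1 = 6
fOffset k2 = 7
fOffset k3 = 4

forbidden : K3 → List Item
forbidden k = edg (eOffset k) 9 ∷ edg (fOffset k) 8 ∷ vtx (fOffset k) ∷ []

respectsForbidden : K3 → List Edge → Bool
respectsForbidden k m = isMatching m ∧ all (satA m) (forbidden k)

everyK3 : (K3 → Bool) → Bool
everyK3 p = p k1 ∧ (p k2 ∧ p k3)

everyK3-sound : ∀ p k → T (everyK3 p) → T (p k)
everyK3-sound p k1 h = T-∧-proj₁ h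
everyK3-sound p k2 h = T-∧-proj₁ (T-∧-proj₂ {p k1} h)
everyK3-sound p k3 h = T-∧-proj₂ {p k2} (T-∧-proj₂ {p k1} h)

everyFin9-sound : ∀ (p : Fin 9 → Bool) i → T (all p (allFin 9)) → T (p i)
everyFin9-sound p i h = T-all p h (∈-allFin i)

-- Transfer through one hexagon: the glued coefficients of a cell form row i of f(M_k).
cellTables : K3 → Fin 9 → Bool
cellTables k i = tableEq
  (glueTable (sublists (cell k)) (cell k) 5 4 (deleted 1 0 (delˣ M) (delʸ M)) [] (required 1 0 M ++ []))
  (λ a b x y → sum (map (λ l → fMat k i l * selector l a b x y) (allFin 9)))
  where M = modeOf i

cellTables-ok : ∀ k i → T (cellTables k i)
cellTables-ok k i = everyFin9-sound (cellTables k) i (everyK3-sound (λ k → all (cellTables k) (allFin 9)) k tt)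

-- Sublists violating the forbidden items contribute nothing (glueTerm-vanishes); dropping them
-- keeps the enumeration small.
lastCellsTables : K3 → K3 → List (List Edge) → Fin 9 → Bool
lastCellsTables kA kB ms i = tableEq
  (glueTable ms (lastCells kA kB) 9 8 (deleted 1 0 (delˣ M) (delʸ M)) (forbidden kB) (required 1 0 M ++ vtx (eOffset kB) ∷ []))
  (λ a b x y → prodMat (kA ∷ kB ∷ []) i (fromℕ 8) * selector (fromℕ 8) a b x y)
  where M = modeOf i

lastCandidates : K3 → K3 → List (List Edge)
lastCandidates kA kB = filterᵇ (respectsForbidden kB) (sublists (lastCells kA kB))

lastCellsTables-ok : ∀ kA kB i → T (lastCellsTables kA kB (lastCandidates kA kB) i)
lastCellsTables-ok kA kB i =
  everyFin9-sound (lastCellsTables kA kB (lastCandidates kA kB)) i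
    (everyK3-sound (λ kB → all (lastCellsTables kA kB (lastCandidates kA kB)) (allFin 9)) kB
      (everyK3-sound (λ kA → everyK3 λ kB → all (lastCellsTables kA kB (lastCandidates kA kB)) (allFin 9)) kA tt))

module LastTwo {K : Graph} {P : ℕ} (H : Attachment K P) (kA kB : K3) where
  open Attached H

  private
    s = 4 * P

  Aᶠ Bᵉ : List Item
  Aᶠ = map (shiftItem s) (forbidden kB)
  Bᵉ = vtx (s + eOffset kB) ∷ []

  ψK : ℕ
  ψK = Ψ∣ K (vtx c ∷ [])

  private
    E₁ = map (shift s) (lastCells kA kB)

    split : chainFrom P (kA ∷ kB ∷ []) ++ Kʳ ↭ᴱ E₁ ++ E K
    split = ↭ᴱ-trans (↭ᴱ-reflexive regroup)
      (↭ᴱ-trans (prep _ (↭ᴱ-++ˡ (map (shift s) (hexEdges 0 kA))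
        (↭ᴱ-trans (hexEdges-1-↭ᴱ s kB Kʳ) (↭ᴱ-++ˡ (map (shift s) (map (shift 4) (hexRest kB))) (↭ᴱ-sym E-K↭ᴱ)))))
        (↭ᴱ-reflexive ungroup))
      where
      regroup : chainFrom P (kA ∷ kB ∷ []) ++ Kʳ
              ≡ (s , s + 1) ∷ (map (shift s) (hexEdges 0 kA) ++ (map (shift s) (hexEdges 1 kB) ++ Kʳ))
      regroup rewrite hexEdges-shift P kA | hexEdges-suc P kB | ++-identityʳ (map (shift s) (hexEdges 1 kB)) =
        cong ((s , s + 1) ∷_) (++-assoc (map (shift s) (hexEdges 0 kA)) (map (shift s) (hexEdges 1 kB)) Kʳ)
      ungroup : (s , s + 1) ∷ (map (shift s) (hexEdges 0 kA) ++ (map (shift s) (map (shift 4) (hexRest kB)) ++ E K))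
              ≡ E₁ ++ E K
      ungroup rewrite map-++ (shift s) (hexEdges 0 kA) (map (shift 4) (hexRest kB)) | +-identityʳ s =
        cong ((s , s + 1) ∷_) (sym (++-assoc (map (shift s) (hexEdges 0 kA)) (map (shift s) (map (shift 4) (hexRest kB))) (E K)))

    below-c : ∀ a → a < 8 → covers (E K) (s + a) ≡ false
    below-c a a<8 = uncovered-in-K (s + a) (+-monoʳ-< s (≤-trans a<8 (≤ᵇ⇒≤ 8 10 tt)))
      (λ eq → <⇒≢ (+-monoʳ-< s (≤-trans a<8 (≤ᵇ⇒≤ 8 9 tt))) eq)
      (λ eq → <⇒≢ (+-monoʳ-< s a<8) eq)

    rung-outside : ∀ d → (d ≡ s + 1) ⊎ (d ≡ s) → covers (E K) d ≡ false
    rung-outside d (inj₁ refl) = below-c 1 (s≤s (s≤s z≤n))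
    rung-outside d (inj₂ refl) = subst (λ z → covers (E K) z ≡ false) (+-identityʳ s) (below-c 0 (s≤s z≤n))

    offsets<8 : ∀ k → (eOffset k < 8) × (fOffset k < 8)
    offsets<8 k1 = ≤ᵇ⇒≤ 6 8 tt , ≤ᵇ⇒≤ 7 8 tt
    offsets<8 k2 = ≤ᵇ⇒≤ 7 8 tt , ≤ᵇ⇒≤ 8 8 tt
    offsets<8 k3 = ≤ᵇ⇒≤ 8 8 tt , ≤ᵇ⇒≤ 5 8 tt

    lastCells-≤9 : T (endpointsAtMost 9 (lastCells kA kB))
    lastCells-≤9 = everyK3-sound (λ kB → endpointsAtMost 9 (lastCells kA kB)) kB
      (everyK3-sound (λ kA → everyK3 λ kB → endpointsAtMost 9 (lastCells kA kB)) kA tt)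

    gluable : ∀ i → let M = modeOf i in
      Gluable E₁ (E K) (s + 9) (s + 8) (deleted (s + 1) s (delˣ M) (delʸ M))
              Aᶠ [] (required (s + 1) s M ++ map (shiftItem s) (vtx (eOffset kB) ∷ [])) []
    gluable i = record
      { meet = meet ; D-outside = λ d d∈ → rung-outside d (∈-deleted (delˣ M) (delʸ M) d∈)
      ; A₁-outside = A-outside ; B₁-outside = B-outside ; A₂-outside = λ _ () ; B₂-outside = λ _ () }
      where
      M = modeOf i
      meet : MeetOnlyAt E₁ (E K) (s + 9) (s + 8)
      meet p h₁ h₂ with covers-map-shift-≤ s 9 (lastCells kA kB) p lastCells-≤9 h₁
      ... | a , refl , a≤9 = low-vertices (s + a) (covered-in-K (s + a) h₂) (+-monoʳ-< s (s≤s a≤9))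
      A-outside : ∀ it → it ∈ Aᶠ → Outside (E K) it
      A-outside _ (here refl) = below-c (eOffset kB) (proj₁ (offsets<8 kB))
      A-outside _ (there (here refl)) = below-c (fOffset kB) (proj₂ (offsets<8 kB))
      A-outside _ (there (there (here refl))) = below-c (fOffset kB) (proj₂ (offsets<8 kB))
      B-outside : ∀ it → it ∈ required (s + 1) s M ++ Bᵉ → Outside (E K) it
      B-outside it it∈ with ∈-++⁻ (required (s + 1) s M) it∈
      ... | inj₂ (here refl) = below-c (eOffset kB) (proj₁ (offsets<8 kB))
      ... | inj₁ r with ∈-required M r
      ...   | inj₁ refl = rung-outside (s + 1) (inj₁ refl)
      ...   | inj₂ refl = rung-outside s (inj₂ refl)

  last-two : ∀ i → component (chainFrom P (kA ∷ kB ∷ []) ++ Kʳ) (s + 1) s Aᶠ Bᵉ i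
                   ≡ prodMat (kA ∷ kB ∷ []) i (fromℕ 8) * ψK
  last-two i =
    begin
      component (chainFrom P (kA ∷ kB ∷ []) ++ Kʳ) (s + 1) s Aᶠ Bᵉ i
    ≡⟨ cong₂ (λ A′ B′ → component (chainFrom P (kA ∷ kB ∷ []) ++ Kʳ) (s + 1) s A′ B′ i)
             (sym (++-identityʳ Aᶠ)) (sym (++-identityʳ Bᵉ)) ⟩
      component (chainFrom P (kA ∷ kB ∷ []) ++ Kʳ) (s + 1) s (Aᶠ ++ []) (Bᵉ ++ []) i
    ≡⟨ component-glued s (lastCells kA kB) (E K) 9 8 (forbidden kB) (vtx (eOffset kB) ∷ []) [] [] i split (gluable i) ⟩
      sum (map (glueTerm (lastCells kA kB) 9 8 D A B N) (sublists (lastCells kA kB)))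
    ≡⟨ sum-filterᵇ _ (respectsForbidden kB) (sublists (lastCells kA kB)) (glueTerm-vanishes (lastCells kA kB) 9 8 D A B N) ⟩
      sum (map (glueTerm (lastCells kA kB) 9 8 D A B N) (lastCandidates kA kB))
    ≡⟨ glueSum-· (lastCandidates kA kB) (lastCells kA kB) 9 8 D A B N ⟩
      glueTable (lastCandidates kA kB) (lastCells kA kB) 9 8 D A B · N
    ≡⟨ ·-congˡ table table′ N (tableEq-sound table table′ (lastCellsTables-ok kA kB i)) ⟩
      (λ a b x y → Mᵢ₈ * selector (fromℕ 8) a b x y) · N
    ≡⟨ sym (*-·ˡ Mᵢ₈ (selector (fromℕ 8)) N) ⟩
      Mᵢ₈ * (selector (fromℕ 8) · N)
    ≡⟨ cong (Mᵢ₈ *_) (sym (trans (Ψ⁻-#maxMatchings [] K (vtx c ∷ [])) (component-selector (E K) d c [] [] (fromℕ 8)))) ⟩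
      Mᵢ₈ * ψK
    ∎
    where
    M = modeOf i
    D = deleted 1 0 (delˣ M) (delʸ M)
    A = forbidden kB
    B = required 1 0 M ++ vtx (eOffset kB) ∷ []
    N = profile (E K) (s + 9) (s + 8) [] []
    Mᵢ₈ = prodMat (kA ∷ kB ∷ []) i (fromℕ 8)
    table = glueTable (lastCandidates kA kB) (lastCells kA kB) 9 8 D A B
    table′ = λ a b x y → Mᵢ₈ * selector (fromℕ 8) a b x y

module Step {K : Graph} {P : ℕ} (H : Attachment K P) (kA kB : K3)
            (k : K3) (pre : List K3) (j : ℕ) (j+1+pre≡P : j + suc (length pre) ≡ P) where
  open Attached H
  open LastTwo H kA kB using (Aᶠ; Bᵉ; ψK)

  private
    s = 4 * j
    rest = pre ++ kA ∷ kB ∷ []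
    E₁ = map (shift s) (cell k)
    E₂ = chainFrom (suc j) rest ++ Kʳ

    split : chainFrom j (k ∷ rest) ++ Kʳ ↭ᴱ E₁ ++ E₂
    split = ↭ᴱ-trans (↭ᴱ-reflexive regroup)
      (↭ᴱ-trans (prep _ (hexEdges-0-↭ᴱ s k (chainEdges (suc j) rest ++ Kʳ))) (↭ᴱ-reflexive ungroup))
      where
      regroup : chainFrom j (k ∷ rest) ++ Kʳ ≡ (s , s + 1) ∷ (map (shift s) (hexEdges 0 k) ++ (chainEdges (suc j) rest ++ Kʳ))
      regroup rewrite hexEdges-shift j k = cong ((s , s + 1) ∷_) (++-assoc (map (shift s) (hexEdges 0 k)) (chainEdges (suc j) rest) Kʳ)
      ungroup : (s , s + 1) ∷ (map (shift s) (hexRest k) ++ ((s + 4 , s + 5) ∷ (chainEdges (suc j) rest ++ Kʳ))) ≡ E₁ ++ E₂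
      ungroup rewrite +-identityʳ s | 4*suc≡ j | 4*suc j 1 = refl

    far : ∀ c → 4 * P + c ≡ s + (4 * suc (length pre) + c)
    far c = trans (cong (λ z → 4 * z + c) (sym j+1+pre≡P)) (arith j (length pre) c)
      where
      arith : ∀ j l c → 4 * (j + suc l) + c ≡ 4 * j + (4 * suc l + c)
      arith = solve-∀

    far-≥ : ∀ c → 6 ≤ 4 + c → 6 ≤ 4 * suc (length pre) + c
    far-≥ c h = ≤-trans h (subst (4 + c ≤_) (sym (arith (length pre) c)) (m≤m+n (4 + c) (4 * length pre)))
      where
      arith : ∀ l c → 4 * suc l + c ≡ 4 + c + 4 * l
      arith = solve-∀

    shifted-≢ : ∀ a b → a < b → s + a ≡ s + b → ⊥
    shifted-≢ a b a<b eq = <⇒≢ a<b (+-cancelˡ-≡ s a b eq)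

    not-in-K : ∀ a → a ≤ 5 → T (memV (s + a) (V K)) → ⊥
    not-in-K a a≤5 a∈
      with low-vertices (s + a) a∈ (subst (s + a <_) (sym (far 10)) (+-monoʳ-< s (≤-trans (s≤s a≤5) (far-≥ 10 (≤ᵇ⇒≤ 6 14 tt)))))
    ... | inj₁ eq = shifted-≢ a _ (≤-trans (s≤s a≤5) (far-≥ 9 (≤ᵇ⇒≤ 6 13 tt))) (trans eq (far 9))
    ... | inj₂ eq = shifted-≢ a _ (≤-trans (s≤s a≤5) (far-≥ 8 (≤ᵇ⇒≤ 6 12 tt))) (trans eq (far 8))

    covers-E₁ : ∀ p → T (covers E₁ p) → Σ ℕ (λ a → (p ≡ s + a) × (a ≤ 5))
    covers-E₁ p h = covers-map-shift-≤ s 5 (cell k) p (bounded k) h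
      where
      bounded : ∀ k → T (endpointsAtMost 5 (cell k))
      bounded k = everyK3-sound (λ k → endpointsAtMost 5 (cell k)) k tt

    covers-E₂ : ∀ p → T (covers E₂ p) → (s + 4 ≤ p) ⊎ T (memV p (V K))
    covers-E₂ p h with covers-++⁻ (chainFrom (suc j) rest) Kʳ p h
    ... | inj₂ hK = inj₂ (covered-in-K p (covers-filterᵇ _ (E K) p hK))
    ... | inj₁ hc with T-∨-elim {incident p (4 * suc j , 4 * suc j + 1)} hc
    ...   | inj₂ hch = inj₁ (subst (_≤ p) (4*suc≡ j) (covers-chainEdges-≥ (suc j) rest p hch))
    ...   | inj₁ i with T-∨-elim {p ≡ᵇ 4 * suc j} i
    ...     | inj₁ q rewrite T-≡ᵇ {p} q = inj₁ (≤-reflexive (sym (4*suc≡ j)))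
    ...     | inj₂ q rewrite T-≡ᵇ {p} q = inj₁ (≤-trans (m≤m+n (s + 4) 1) (≤-reflexive (cong (_+ 1) (sym (4*suc≡ j)))))

    below-E₂ : ∀ a → a < 4 → covers E₂ (s + a) ≡ false
    below-E₂ a a<4 = ¬T⇒≡false λ h → impossible (covers-E₂ (s + a) h)
      where
      impossible : (s + 4 ≤ s + a) ⊎ T (memV (s + a) (V K)) → ⊥
      impossible (inj₁ le) = <⇒≱ a<4 (+-cancelˡ-≤ s 4 a le)
      impossible (inj₂ a∈) = not-in-K a (≤-trans (<⇒≤ a<4) (≤ᵇ⇒≤ 4 5 tt)) a∈

    rung-outside : ∀ d → (d ≡ s + 1) ⊎ (d ≡ s) → covers E₂ d ≡ false
    rung-outside d (inj₁ refl) = below-E₂ 1 (s≤s (s≤s z≤n))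
    rung-outside d (inj₂ refl) = subst (λ z → covers E₂ z ≡ false) (+-identityʳ s) (below-E₂ 0 (s≤s z≤n))

    beyond-E₁ : ∀ c → 2 ≤ c → covers E₁ (4 * P + c) ≡ false
    beyond-E₁ c 2≤c = ¬T⇒≡false λ h → impossible (covers-E₁ (4 * P + c) h)
      where
      impossible : Σ ℕ (λ a → (4 * P + c ≡ s + a) × (a ≤ 5)) → ⊥
      impossible (a , eq , a≤5) =
        shifted-≢ a _ (≤-trans (s≤s a≤5) (far-≥ c (+-monoʳ-≤ 4 2≤c))) (trans (sym eq) (far c))

    offsets≥2 : ∀ k → (2 ≤ eOffset k) × (2 ≤ fOffset k)
    offsets≥2 k1 = ≤ᵇ⇒≤ 2 5 tt , ≤ᵇ⇒≤ 2 6 tt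
    offsets≥2 k2 = ≤ᵇ⇒≤ 2 6 tt , ≤ᵇ⇒≤ 2 7 tt
    offsets≥2 k3 = ≤ᵇ⇒≤ 2 7 tt , ≤ᵇ⇒≤ 2 4 tt

    interface : ∀ a → 4 ≤ a → a ≤ 5 → (a ≡ 5) ⊎ (a ≡ 4)
    interface 4 _ _ = inj₂ refl
    interface 5 _ _ = inj₁ refl
    interface 0 () _
    interface 1 (s≤s ()) _
    interface 2 (s≤s (s≤s ())) _
    interface 3 (s≤s (s≤s (s≤s ()))) _
    interface (suc (suc (suc (suc (suc (suc a)))))) _ (s≤s (s≤s (s≤s (s≤s (s≤s ())))))

    gluable : ∀ i → let M = modeOf i in
      Gluable E₁ E₂ (s + 5) (s + 4) (deleted (s + 1) s (delˣ M) (delʸ M)) [] Aᶠ (required (s + 1) s M ++ []) Bᵉ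
    gluable i = record
      { meet = meet ; D-outside = λ d d∈ → rung-outside d (∈-deleted (delˣ M) (delʸ M) d∈)
      ; A₁-outside = λ _ () ; B₁-outside = B-outside ; A₂-outside = A-outside
      ; B₂-outside = λ { _ (here refl) → beyond-E₁ (eOffset kB) (proj₁ (offsets≥2 kB)) } }
      where
      M = modeOf i
      meet : MeetOnlyAt E₁ E₂ (s + 5) (s + 4)
      meet p h₁ h₂ with covers-E₁ p h₁
      ... | a , refl , a≤5 with covers-E₂ (s + a) h₂
      ...   | inj₂ a∈ = ⊥-elim (not-in-K a a≤5 a∈)
      ...   | inj₁ le with interface a (+-cancelˡ-≤ s 4 a le) a≤5
      ...     | inj₁ refl = inj₁ refl
      ...     | inj₂ refl = inj₂ refl
      B-outside : ∀ it → it ∈ required (s + 1) s M ++ [] → Outside E₂ it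
      B-outside it it∈ with ∈-required M (subst (it ∈_) (++-identityʳ (required (s + 1) s M)) it∈)
      ... | inj₁ refl = rung-outside (s + 1) (inj₁ refl)
      ... | inj₂ refl = rung-outside s (inj₂ refl)
      A-outside : ∀ it → it ∈ Aᶠ → Outside E₁ it
      A-outside _ (here refl) = beyond-E₁ (eOffset kB) (proj₁ (offsets≥2 kB))
      A-outside _ (there (here refl)) = beyond-E₁ (fOffset kB) (proj₂ (offsets≥2 kB))
      A-outside _ (there (there (here refl))) = beyond-E₁ (fOffset kB) (proj₂ (offsets≥2 kB))

    sum-*-assoc : ∀ {A : Set} (a b : A → ℕ) c ls → sum (map (λ l → a l * (b l * c)) ls) ≡ sum (map (λ l → a l * b l) ls) * c
    sum-*-assoc a b c [] = refl
    sum-*-assoc a b c (l ∷ ls) =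
      trans (cong₂ _+_ (sym (*-assoc (a l) (b l) c)) (sum-*-assoc a b c ls)) (sym (*-distribʳ-+ c (a l * b l) _))

  step : (∀ l → component E₂ (4 * suc j + 1) (4 * suc j) Aᶠ Bᵉ l ≡ prodMat rest l (fromℕ 8) * ψK) →
         ∀ i → component (chainFrom j (k ∷ rest) ++ Kʳ) (s + 1) s Aᶠ Bᵉ i ≡ prodMat (k ∷ rest) i (fromℕ 8) * ψK
  step IH i =
    begin
      component (chainFrom j (k ∷ rest) ++ Kʳ) (s + 1) s Aᶠ Bᵉ i
    ≡⟨ component-glued s (cell k) E₂ 5 4 [] [] Aᶠ Bᵉ i split (gluable i) ⟩
      sum (map (glueTerm (cell k) 5 4 D [] B N) (sublists (cell k)))
    ≡⟨ glueSum-· (sublists (cell k)) (cell k) 5 4 D [] B N ⟩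
      table · N
    ≡⟨ ·-congˡ table table′ N (tableEq-sound table table′ (cellTables-ok k i)) ⟩
      table′ · N
    ≡⟨ sym (sum-·ˡ (allFin 9) (fMat k i) selector N) ⟩
      sum (map (λ l → fMat k i l * (selector l · N)) (allFin 9))
    ≡⟨ sum-map-cong _ _ (allFin 9) (λ l → cong (fMat k i l *_) (next l)) ⟩
      sum (map (λ l → fMat k i l * (prodMat rest l (fromℕ 8) * ψK)) (allFin 9))
    ≡⟨ sum-*-assoc (fMat k i) (λ l → prodMat rest l (fromℕ 8)) ψK (allFin 9) ⟩
      prodMat (k ∷ rest) i (fromℕ 8) * ψK
    ∎
    where
    M = modeOf i
    D = deleted 1 0 (delˣ M) (delʸ M)
    B = required 1 0 M ++ []
    N = profile E₂ (s + 5) (s + 4) Aᶠ Bᵉ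
    table = glueTable (sublists (cell k)) (cell k) 5 4 D [] B
    table′ = λ a b x y → sum (map (λ l → fMat k i l * selector l a b x y) (allFin 9))
    next : ∀ l → selector l · N ≡ prodMat rest l (fromℕ 8) * ψK
    next l = trans (sym (component-selector E₂ (s + 5) (s + 4) Aᶠ Bᵉ l))
      (trans (cong₂ (λ x y → component E₂ x y Aᶠ Bᵉ l) (sym (4*suc j 1)) (sym (4*suc≡ j))) (IH l))

module Chain {K : Graph} {P : ℕ} (H : Attachment K P) (kA kB : K3) where
  open Attached H
  open LastTwo H kA kB

  chain-component : ∀ pre j → j + length pre ≡ P → ∀ i →
    component (chainFrom j (pre ++ kA ∷ kB ∷ []) ++ Kʳ) (4 * j + 1) (4 * j) Aᶠ Bᵉ i
      ≡ prodMat (pre ++ kA ∷ kB ∷ []) i (fromℕ 8) * ψK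
  chain-component [] j j+0≡P i with trans (sym (+-identityʳ j)) j+0≡P
  ... | refl = last-two i
  chain-component (k ∷ pre) j eq =
    Step.step H kA kB k pre j eq (chain-component pre (suc j) (trans (sym (+-suc j (length pre))) eq))

split-last-two : ∀ P (ks : Vec K3 (suc (suc P))) →
  Σ (List K3) λ pre → Σ K3 λ kA → (toList ks ≡ pre ++ kA ∷ last ks ∷ []) × (length pre ≡ P)
split-last-two zero (kA ∷ kB ∷ []) = [] , kA , refl , refl
split-last-two (suc P) (k ∷ ks) with split-last-two P ks
... | pre , kA , eq , len = k ∷ pre , kA , cong (k ∷_) eq , cong suc len

vE-offset : ∀ q (ks : Vec K3 (3 + q)) → vE ks ≡ 4 * suc q + eOffset (last ks)
vE-offset q ks with last ks
... | k1 = arith q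
  where arith : ∀ q → 4 * (2 + q) + 1 ≡ 4 * suc q + 5
        arith = solve-∀
... | k2 = arith q
  where arith : ∀ q → 4 * (2 + q) + 2 ≡ 4 * suc q + 6
        arith = solve-∀
... | k3 = arith q
  where arith : ∀ q → 4 * (2 + q) + 3 ≡ 4 * suc q + 7
        arith = solve-∀

vF-offset : ∀ q (ks : Vec K3 (3 + q)) → vF ks ≡ 4 * suc q + fOffset (last ks)
vF-offset q ks with last ks
... | k1 = arith q
  where arith : ∀ q → 4 * (2 + q) + 2 ≡ 4 * suc q + 6
        arith = solve-∀
... | k2 = arith q
  where arith : ∀ q → 4 * (2 + q) + 3 ≡ 4 * suc q + 7
        arith = solve-∀
... | k3 = arith q
  where arith : ∀ q → 4 * (2 + q) ≡ 4 * suc q + 4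
        arith = solve-∀

vD-vC : ∀ q → (vD (3 + q) ≡ 4 * suc q + 9) × (vC (3 + q) ≡ 4 * suc q + 8)
vD-vC q = arith₁ q , arith₂ q
  where
  arith₁ : ∀ q → 4 * (3 + q) + 1 ≡ 4 * suc q + 9
  arith₁ = solve-∀
  arith₂ : ∀ q → 4 * (3 + q) ≡ 4 * suc q + 8
  arith₂ = solve-∀

attachment : ∀ q (ks : Vec K3 (3 + q)) K → T (simpleGraph K) → T (memE (vD (3 + q) , vC (3 + q)) (E K)) →
  (∀ v → (T (memV v (V K)) × T (memV v (V (chainG ks)))) ⇔ (v ≡ vD (3 + q) ⊎ v ≡ vC (3 + q))) →
  Attachment K (suc q)
attachment q ks K simple dc∈K shared = record
  { simple = simple
  ; dc∈K = subst (λ e → T (memE e (E K))) (cong₂ _,_ (proj₁ (vD-vC q)) (proj₂ (vD-vC q))) dc∈K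
  ; low-vertices = low }
  where
  low : ∀ z → T (memV z (V K)) → z < 4 * suc q + 10 → (z ≡ 4 * suc q + 9) ⊎ (z ≡ 4 * suc q + 8)
  low z z∈K z< with Equivalence.to (shared z) (z∈K , memV-upTo z (4 * (3 + q) + 2) (subst (z <_) (sym (arith q)) z<))
    where arith : ∀ q → 4 * (3 + q) + 2 ≡ 4 * suc q + 10
          arith = solve-∀
  ... | inj₁ z≡d = inj₁ (trans z≡d (proj₁ (vD-vC q)))
  ... | inj₂ z≡c = inj₂ (trans z≡c (proj₂ (vD-vC q)))

module _ {q : ℕ} {ks : Vec K3 (3 + q)} {K : Graph} (H : Attachment K (suc q))
         {pre : List K3} {kA : K3} (ks≡ : toList ks ≡ pre ++ kA ∷ last ks ∷ []) (|pre| : length pre ≡ suc q) where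
  open Attached H
  open LastTwo H kA (last ks)

  Ψvec-ring-component : ∀ i →
    Ψvec (edg (vE ks) (vD (3 + q)) ∷ edg (vF ks) (vC (3 + q)) ∷ vtx (vF ks) ∷ []) (chainG ks ∪G K) vA vB (vtx (vE ks) ∷ []) i
      ≡ component (chainFrom 0 (pre ++ kA ∷ last ks ∷ []) ++ Kʳ) 1 0 Aᶠ Bᵉ i
  Ψvec-ring-component i =
    trans (Ψvec-component _ _ 1 0 _ _ i)
      (cong₃ (λ L A B → component L 1 0 A B i) edges forbidden≡ (cong (λ e → vtx e ∷ []) (vE-offset q ks)))
    where
    cong₃ : ∀ {A B C D : Set} (f : A → B → C → D) {a a′ b b′ c c′}
        → a ≡ a′ → b ≡ b′ → c ≡ c′ → f a b c ≡ f a′ b′ c′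
    cong₃ f refl refl refl = refl
    rest : List K3 → List Edge
    rest ls = filterᵇ (λ e → not (memE e (chainFrom 0 ls))) (E K)
    edges : chainFrom 0 (toList ks) ++ rest (toList ks) ≡ chainFrom 0 (pre ++ kA ∷ last ks ∷ []) ++ Kʳ
    edges rewrite ks≡ = cong (chainFrom 0 (pre ++ kA ∷ last ks ∷ []) ++_) (K-without-chain kA (last ks) pre 0 |pre|)
    forbiddenAt : ℕ → ℕ → ℕ → ℕ → List Item
    forbiddenAt e f d c = edg e d ∷ edg f c ∷ vtx f ∷ []
    forbiddenAt-cong : ∀ {e f d c e′ f′ d′ c′} → e ≡ e′ → f ≡ f′ → d ≡ d′ → c ≡ c′ →
      forbiddenAt e f d c ≡ forbiddenAt e′ f′ d′ c′
    forbiddenAt-cong refl refl refl refl = refl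
    forbidden≡ : forbiddenAt (vE ks) (vF ks) (vD (3 + q)) (vC (3 + q)) ≡ Aᶠ
    forbidden≡ = forbiddenAt-cong (vE-offset q ks) (vF-offset q ks) (proj₁ (vD-vC q)) (proj₂ (vD-vC q))

lemma7 : (n : ℕ) → 3 ≤ n → (ks : Vec K3 n) → (K : Graph) →
    T (simpleGraph K) →
    T (memE (vD n , vC n) (E K)) →
    (∀ v → (T (memV v (V K)) × T (memV v (V (chainG ks)))) ⇔ (v ≡ vD n ⊎ v ≡ vC n)) →
    (∀ u w → (T (memE (u , w) (E K)) × T (memE (u , w) (E (chainG ks)))) ⇔ T (sameEdge (u , w) (vD n , vC n))) →
    (i : Fin 9) →
    Ψvec (edg (vE ks) (vD n) ∷ edg (vF ks) (vC n) ∷ vtx (vF ks) ∷ []) (chainG ks ∪G K) vA vB (vtx (vE ks) ∷ []) i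
      ≡ Mring ks i (fromℕ 8) * Ψ∣ K (vtx (vC n) ∷ [])
lemma7 (suc (suc (suc q))) (s≤s (s≤s (s≤s z≤n))) ks K simple dc∈K shared _ i with split-last-two (suc q) ks
... | pre , kA , ks≡ , |pre| =
  trans (Ψvec-ring-component H ks≡ |pre| i)
   (trans (Chain.chain-component H kA (last ks) pre 0 |pre| i)
     (cong₂ (λ ls c → prodMat ls i (fromℕ 8) * Ψ∣ K (vtx c ∷ [])) (sym ks≡) (sym (proj₂ (vD-vC q)))))
  where
  H = attachment q ks K simple dc∈K shared
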